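{- There is a unique MERW associated with the (unweighted) Young lattice $\mathbb Y$, and it is the Plancherel growth process, i.e. the Markov chain $(\lambda_n)_{n\ge0}$ on $\mathbb Y$ started at the empty diagram whose harmonic function is $\varphi(\lambda)=\frac{d(\varnothing,\lambda)}{n!}$ for $\lambda\vdash n$ (equivalently, $\mathbb P(\lambda_n=\lambda)=\frac{d(\varnothing,\lambda)^2}{n!}$ for $\lambda\vdash n$, with transition probabilities $p(\lambda,\Lambda)=\frac{d(\varnothing,\Lambda)}{(n+1)\,d(\varnothing,\lambda)}$ for $\lambda\vdash n$ and $\lambda\nearrow\Lambda$).
   Context: The Young lattice $\mathbb Y=\bigsqcup_{n\ge0}\mathbb Y_n$ is the graded graph whose $n$-th level $\mathbb Y_n$ is the set of partitions (Young diagrams) $\lambda\vdash n$, with $\mathbb Y_0=\{\varnothing\}$, and with an edge $\lambda\nearrow\Lambda$ iff $\Lambda$ is obtained from $\lambda$ by adding one box. $d(\lambda,\mu)$ is the number of directed paths from $\lambda$ to $\mu$ (so $d(\varnothing,\lambda)$ is the number of standard Young tableaux of shape $\lambda$), and $d(\lambda,\mathbb Y_n)=\sum_{\mu\vdash n}d(\lambda,\mu)$. Definition of MERW: let $\varphi_n(\lambda)=d(\lambda,\mathbb Y_n)/d(\varnothing,\mathbb Y_n)$. If $\varphi^*$ is a pointwise limit of $\varphi_{n_k}$ along some subsequence $n_k\to\infty$, the associated MERW is the Markov chain started at $\varnothing$ with transition probabilities $p(\lambda,\Lambda)=\varphi^*(\Lambda)/\varphi^*(\lambda)$, $\lambda\nearrow\Lambda$,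 on $\{\varphi^*>0\}$. MERWs are the Markov chains arising in this way. -}

module Defs where

open import Data.Integer.Base using (+_)
open import Data.List.Base using (List; []; _∷_; map; length; concat; mapMaybe; deduplicate; foldr)
import Data.List.Properties as List
open import Data.List.Membership.Propositional using (_∈_)
open import Data.List.Membership.Propositional.Properties
  using (∈-map⁺; ∈-map⁻; ∈-concat⁺′; ∈-concat⁻′; ∈-deduplicate⁺; ∈-deduplicate⁻; ∈-length)
open import Data.List.Relation.Binary.Disjoint.Propositional using (Disjoint)
open import Data.List.Relation.Unary.All as All using (All; []; _∷_)
import Data.List.Relation.Unary.All.Properties as All
open import Data.List.Relation.Unary.AllPairs as AllPairs using ([]; _∷_)
import Data.List.Relation.Unary.AllPairs.Properties as AllPairs
open import Data.List.Relation.Unary.Any using (here; there)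
open import Data.List.Relation.Unary.Linked using (Linked; []; [-]; _∷_; linked?)
open import Data.List.Relation.Unary.Unique.Propositional using (Unique)
import Data.List.Relation.Unary.Unique.Propositional.Properties as Unique
import Data.List.Relation.Unary.Unique.DecPropositional.Properties as Dedup
open import Data.Maybe.Base using (Maybe; just; nothing)
open import Data.Nat.Base as ℕ using (ℕ; zero; suc; _∸_; _≥_; z≤n; s≤s; _!)
open import Data.Nat.ListAction using (sum)
import Data.Nat.Properties as ℕ
open import Data.Product using (∃; _×_; _,_; proj₁; proj₂)
open import Data.Rational.Base as ℚ using (ℚ; 0ℚ; 1ℚ; ½)
import Data.Rational.Properties as ℚ
open import Data.Rational.Solver using (module +-*-Solver)
open import Function.Base using (case_of_)
open import Function.Bundles using (_⇔_; mk⇔; Equivalence)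
open import Relation.Binary.Construct.Closure.ReflexiveTransitive using (Star; _◅_; _◅◅_) renaming (ε to done)
open import Relation.Binary.Definitions using (DecidableEquality)
open import Relation.Binary.PropositionalEquality
  using (_≡_; _≢_; refl; sym; trans; cong; cong₂; subst; subst₂)
open import Relation.Nullary using (¬_; Dec; yes; no; contradiction; recompute; map′; _×-dec_)

------------------------------------------------------------------------
-- Partitions (Young diagrams)

IsPartition : List ℕ → Set
IsPartition xs = Linked _≥_ xs × All (1 ℕ.≤_) xs

isPartition? : ∀ xs → Dec (IsPartition xs)
isPartition? xs = linked? ℕ._≥?_ xs ×-dec All.all? (1 ℕ.≤?_) xs

-- The validity proof is irrelevant, so two partitions with the same rows
-- are definitionally equal.
record Partition : Set where
  constructor partition
  field
    rows   : List ℕ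
    .valid : IsPartition rows

open Partition public

∅ : Partition
∅ = partition [] ([] , [])

size : Partition → ℕ
size μ = sum (rows μ)

infix 4 _≟_

_≟_ : DecidableEquality Partition
partition xs _ ≟ partition ys _ =
  map′ (λ { refl → refl }) (cong rows) (List.≡-dec ℕ._≟_ xs ys)

------------------------------------------------------------------------
-- Edges of the Young lattice

data AddBox : List ℕ → List ℕ → Set where
  new   : AddBox [] (1 ∷ [])
  here  : ∀ {x xs} → AddBox (x ∷ xs) (suc x ∷ xs)
  there : ∀ {x xs ys} → AddBox xs ys → AddBox (x ∷ xs) (x ∷ ys)

infix 4 _↗_

record _↗_ (μ ν : Partition) : Set where
  constructor edge
  field
    addBox : AddBox (rows μ) (rows ν)

addBox-sum : ∀ {xs ys} → AddBox xs ys → sum ys ≡ suc (sum xs)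
addBox-sum new               = refl
addBox-sum here              = refl
addBox-sum (there {x = x} b) = trans (cong (x ℕ.+_) (addBox-sum b)) (ℕ.+-suc x _)

↗-size : ∀ {μ ν} → μ ↗ ν → size ν ≡ suc (size μ)
↗-size (edge b) = addBox-sum b

addBoxes : ∀ xs → List (∃ (AddBox xs))
addBoxes []       = (1 ∷ [] , new) ∷ []
addBoxes (x ∷ xs) =
  (suc x ∷ xs , here) ∷ map (λ (ys , b) → x ∷ ys , there b) (addBoxes xs)

toEdge : ∀ {μ} → ∃ (AddBox (rows μ)) → Maybe (∃ (μ ↗_))
toEdge (ys , b) with isPartition? ys
... | yes p = just (partition ys p , edge b)
... | no  _ = nothing

-- The outgoing edges of μ, each listed exactly once (∈-up and up-unique).
up : ∀ μ → List (∃ (μ ↗_))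
up μ = mapMaybe toEdge (addBoxes (rows μ))

∈-addBoxes : ∀ {xs ys} (b : AddBox xs ys) → (ys , b) ∈ addBoxes xs
∈-addBoxes new       = here refl
∈-addBoxes here      = here refl
∈-addBoxes (there b) = there (∈-map⁺ _ (∈-addBoxes b))

addBoxes-unique : ∀ xs → Unique (addBoxes xs)
addBoxes-unique []       = [] ∷ []
addBoxes-unique (x ∷ xs) =
  All.map⁺ (All.universal (λ _ ()) (addBoxes xs)) ∷
  Unique.map⁺ (λ { refl → refl }) (addBoxes-unique xs)

private
  module _ {A B : Set} {f : A → Maybe B} where

    ∈-mapMaybe⁺ : ∀ {xs x y} → x ∈ xs → f x ≡ just y → y ∈ mapMaybe f xs
    ∈-mapMaybe⁺ {x ∷ xs} (here refl) eq with just z ← f x | refl ← eq = here refl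
    ∈-mapMaybe⁺ {x ∷ xs} (there m) eq with f x
    ... | just _  = there (∈-mapMaybe⁺ m eq)
    ... | nothing = ∈-mapMaybe⁺ m eq

    ∈-mapMaybe⁻ : ∀ xs {y} → y ∈ mapMaybe f xs → ∃ λ x → x ∈ xs × f x ≡ just y
    ∈-mapMaybe⁻ (x ∷ xs) m with f x in eq
    ∈-mapMaybe⁻ (x ∷ xs) (here refl) | just _ = x , here refl , eq
    ∈-mapMaybe⁻ (x ∷ xs) (there m)   | just _ with ∈-mapMaybe⁻ xs m
    ... | x′ , m′ , eq′ = x′ , there m′ , eq′
    ∈-mapMaybe⁻ (x ∷ xs) m           | nothing with ∈-mapMaybe⁻ xs m
    ... | x′ , m′ , eq′ = x′ , there m′ , eq′

    mapMaybe-unique : (∀ {x x′ y} → f x ≡ just y → f x′ ≡ just y → x ≡ x′) →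
                      ∀ {xs} → Unique xs → Unique (mapMaybe f xs)
    mapMaybe-unique inj {[]}     []          = []
    mapMaybe-unique inj {x ∷ xs} (x∉xs ∷ xs!) with f x in eq
    ... | nothing = mapMaybe-unique inj xs!
    ... | just y  = All.tabulate (λ m y≡z → case ∈-mapMaybe⁻ xs m of λ
      { (x′ , m′ , eq′) →
          All.lookup x∉xs m′ (inj eq (trans eq′ (cong just (sym y≡z)))) })
      ∷ mapMaybe-unique inj xs!

∈-up : ∀ {μ ν} (e : μ ↗ ν) → (ν , e) ∈ up μ
∈-up {μ} {ν@(partition ys v)} (edge b) = ∈-mapMaybe⁺ (∈-addBoxes b) eq
  where
  eq : toEdge {μ} (ys , b) ≡ just (ν , edge b)
  eq with isPartition? ys
  ... | yes _ = refl
  ... | no ¬p = contradiction (recompute (isPartition? ys) v) ¬p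

up-unique : ∀ μ → Unique (up μ)
up-unique μ = mapMaybe-unique inj (addBoxes-unique (rows μ))
  where
  strip : ∃ (μ ↗_) → ∃ (AddBox (rows μ))
  strip (ν , edge b) = rows ν , b

  toEdge-strip : ∀ x {y} → toEdge {μ} x ≡ just y → x ≡ strip y
  toEdge-strip (ys , b) eq with isPartition? ys
  toEdge-strip (ys , b) refl | yes p = refl

  inj : ∀ {x x′ y} → toEdge {μ} x ≡ just y → toEdge x′ ≡ just y → x ≡ x′
  inj {x} {x′} p q = trans (toEdge-strip x p) (sym (toEdge-strip x′ q))

------------------------------------------------------------------------
-- The levels of the Young lattice

covers : Partition → List Partition
covers μ = map proj₁ (up μ)

-- 𝕐 n lists the partitions of n, each exactly once (∈-𝕐 and 𝕐-unique).
𝕐 : ℕ → List Partition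
𝕐 zero    = ∅ ∷ []
𝕐 (suc n) = deduplicate _≟_ (concat (map covers (𝕐 n)))

𝕐-unique : ∀ n → Unique (𝕐 n)
𝕐-unique zero    = [] ∷ []
𝕐-unique (suc n) = Dedup.deduplicate-! _≟_ _

private
  -- Remove the last box of the last row.
  removeBox : ∀ y ys → IsPartition (y ∷ ys) →
    ∃ λ zs → IsPartition zs × AddBox zs (y ∷ ys) × (∀ {x} → x ≥ y → Linked _≥_ (x ∷ zs))
  removeBox (suc zero) [] (_ , _) = [] , ([] , []) , new , λ _ → [-]
  removeBox (suc (suc k)) [] (_ , _) =
    suc k ∷ [] , ([-] , s≤s z≤n ∷ []) , here , λ x≥y → ℕ.<⇒≤ x≥y ∷ [-]
  removeBox y (y′ ∷ ys) (y≥y′ ∷ l , 1≤y ∷ a) with removeBox y′ ys (l , a)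
  ... | zs , (_ , a′) , b , below =
    y ∷ zs , (below y≥y′ , 1≤y ∷ a′) , there b , λ x≥y → x≥y ∷ below y≥y′

predecessor : ∀ ν {n} → size ν ≡ suc n → ∃ (_↗ ν)
predecessor ν@(partition (y ∷ ys) v) _
  with removeBox y ys (recompute (isPartition? (y ∷ ys)) v)
... | zs , p , b , _ = partition zs p , edge b

private
  size≡0 : ∀ μ → size μ ≡ 0 → μ ≡ ∅
  size≡0 (partition []           _) _ = refl
  size≡0 (partition (suc _ ∷ _)  _) ()
  size≡0 (partition (zero ∷ xs)  v) _
    with () ∷ _ ← proj₂ (recompute (isPartition? (zero ∷ xs)) v)

∈-𝕐 : ∀ {μ n} → μ ∈ 𝕐 n ⇔ size μ ≡ n
∈-𝕐 {μ} {n} = mk⇔ (to n) (from n μ)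
  where
  to : ∀ n {μ} → μ ∈ 𝕐 n → size μ ≡ n
  to zero    (here refl) = refl
  to (suc n) m
    with ∈-concat⁻′ _ (∈-deduplicate⁻ _≟_ (concat (map covers (𝕐 n))) m)
  ... | _ , m₁ , m₂ with ∈-map⁻ covers m₂
  ... | κ , m₃ , refl with ∈-map⁻ proj₁ m₁
  ... | (_ , e) , _ , refl = trans (↗-size e) (cong suc (to n m₃))

  from : ∀ n μ → size μ ≡ n → μ ∈ 𝕐 n
  from zero    μ eq with refl ← size≡0 μ eq = here refl
  from (suc n) μ eq with predecessor μ eq
  ... | κ , e = ∈-deduplicate⁺ _≟_
    (∈-concat⁺′ (∈-map⁺ proj₁ (∈-up e))
                (∈-map⁺ covers (from n κ (ℕ.suc-injective (trans (sym (↗-size e)) eq)))))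

------------------------------------------------------------------------
-- Directed paths and their number

infix 4 _⇝_

_⇝_ : Partition → Partition → Set
_⇝_ = Star _↗_

steps : ∀ {μ ν} → μ ⇝ ν → ℕ
steps done       = 0
steps (_ ◅ w) = suc (steps w)

-- The paths with exactly k edges from μ to ν, each listed exactly once
-- (∈-walks and walks-unique).
walks : ℕ → ∀ μ ν → List (μ ⇝ ν)
walks zero μ ν with μ ≟ ν
... | yes refl = done ∷ []
... | no  _    = []
walks (suc k) μ ν = concat (map (λ (κ , e) → map (e ◅_) (walks k κ ν)) (up μ))

-- Every path from μ to ν has size ν ∸ size μ edges (steps-size), so this is
-- the complete list of paths (∈-paths and paths-unique).
paths : ∀ μ ν → List (μ ⇝ ν)
paths μ ν = walks (size ν ∸ size μ) μ ν

d : Partition → Partition → ℕ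
d μ ν = length (paths μ ν)

d𝕐 : Partition → ℕ → ℕ
d𝕐 μ n = sum (map (d μ) (𝕐 n))

∈-walks : ∀ {μ ν} (w : μ ⇝ ν) → w ∈ walks (steps w) μ ν
∈-walks {μ} done with μ ≟ μ
... | yes refl = here refl
... | no μ≢μ   = contradiction refl μ≢μ
∈-walks (e ◅ w) = ∈-concat⁺′ (∈-map⁺ (e ◅_) (∈-walks w)) (∈-map⁺ _ (∈-up e))

steps-size : ∀ {μ ν} (w : μ ⇝ ν) → steps w ℕ.+ size μ ≡ size ν
steps-size done       = refl
steps-size (e ◅ w) = trans (sym (ℕ.+-suc (steps w) _))
  (trans (cong (steps w ℕ.+_) (sym (↗-size e))) (steps-size w))

∈-paths : ∀ {μ ν} (w : μ ⇝ ν) → w ∈ paths μ ν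
∈-paths {μ} {ν} w = subst (λ k → w ∈ walks k μ ν)
  (trans (sym (ℕ.m+n∸n≡m (steps w) (size μ))) (cong (_∸ size μ) (steps-size w)))
  (∈-walks w)

walks-unique : ∀ k μ ν → Unique (walks k μ ν)
walks-unique zero μ ν with μ ≟ ν
... | yes refl = [] ∷ []
... | no  _    = []
walks-unique (suc k) μ ν = Unique.concat⁺
  (All.map⁺ (All.universal (λ (κ , e) → Unique.map⁺ (λ { refl → refl }) (walks-unique k κ ν)) (up μ)))
  (AllPairs.map⁺ (AllPairs.map disjoint (up-unique μ)))
  where
  disjoint : ∀ {x y : ∃ (μ ↗_)} → x ≢ y →
    Disjoint (map (proj₂ x ◅_) (walks k (proj₁ x) ν)) (map (proj₂ y ◅_) (walks k (proj₁ y) ν))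
  disjoint x≢y (m₁ , m₂) with ∈-map⁻ _ m₁
  ... | _ , _ , refl with ∈-map⁻ _ m₂
  ... | _ , _ , refl = x≢y refl

paths-unique : ∀ μ ν → Unique (paths μ ν)
paths-unique μ ν = walks-unique (size ν ∸ size μ) μ ν

fromRoot : ∀ μ → ∅ ⇝ μ
fromRoot μ = go (size μ) μ refl
  where
  go : ∀ n μ → size μ ≡ n → ∅ ⇝ μ
  go zero    μ eq with refl ← size≡0 μ eq = done
  go (suc n) μ eq with predecessor μ eq
  ... | κ , e = go n κ (ℕ.suc-injective (trans (sym (↗-size e)) eq)) ◅◅ (e ◅ done)

d∅-nonZero : ∀ μ → ℕ.NonZero (d ∅ μ)
d∅-nonZero μ = ℕ.>-nonZero (∈-length (∈-paths (fromRoot μ)))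

private
  row : ℕ → Partition
  row zero    = ∅
  row (suc n) = partition (suc n ∷ []) ([-] , s≤s z≤n ∷ [])

  size-row : ∀ n → size (row n) ≡ n
  size-row zero    = refl
  size-row (suc n) = ℕ.+-identityʳ (suc n)

  ≤-sum-map : ∀ {A : Set} (f : A → ℕ) {x xs} → x ∈ xs → f x ℕ.≤ sum (map f xs)
  ≤-sum-map f (here refl)           = ℕ.m≤m+n _ _
  ≤-sum-map f {xs = y ∷ _} (there m) = ℕ.≤-trans (≤-sum-map f m) (ℕ.m≤n+m _ (f y))

d∅𝕐-nonZero : ∀ n → ℕ.NonZero (d𝕐 ∅ n)
d∅𝕐-nonZero n = ℕ.>-nonZero (ℕ.≤-trans
  (ℕ.>-nonZero⁻¹ (d ∅ (row n)) ⦃ d∅-nonZero (row n) ⦄)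
  (≤-sum-map (d ∅) {row n} {𝕐 n} (Equivalence.from (∈-𝕐 {row n} {n}) (size-row n))))

------------------------------------------------------------------------
-- Real numbers as Cauchy sequences of rationals

record ℝ : Set where
  constructor real
  field
    seq    : ℕ → ℚ
    cauchy : ∀ ε → 0ℚ ℚ.< ε → ∃ λ N → ∀ m n → N ℕ.≤ m → N ℕ.≤ n →
             ℚ.∣ seq m ℚ.- seq n ∣ ℚ.< ε

open ℝ public

infix 4 _≈_ _≤ᴿ_ _<ᴿ_

_≈_ : ℝ → ℝ → Set
x ≈ y = ∀ ε → 0ℚ ℚ.< ε → ∃ λ N → ∀ n → N ℕ.≤ n → ℚ.∣ seq x n ℚ.- seq y n ∣ ℚ.< ε

_≤ᴿ_ : ℝ → ℝ → Set
x ≤ᴿ y = ∀ ε → 0ℚ ℚ.< ε → ∃ λ N → ∀ n → N ℕ.≤ n → seq x n ℚ.≤ seq y n ℚ.+ ε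

_<ᴿ_ : ℝ → ℝ → Set
x <ᴿ y = ∃ λ δ → 0ℚ ℚ.< δ × ∃ λ N → ∀ n → N ℕ.≤ n → seq x n ℚ.+ δ ℚ.≤ seq y n

private
  open +-*-Solver using (solve; _:=_; _:+_; _:-_; :-_; _:*_; con)

  half-pos : ∀ {ε} → 0ℚ ℚ.< ε → 0ℚ ℚ.< ½ ℚ.* ε
  half-pos {ε} 0<ε = subst (ℚ._< ½ ℚ.* ε) (ℚ.*-zeroʳ ½) (ℚ.*-monoʳ-<-pos ½ 0<ε)

  halves : ∀ ε → ½ ℚ.* ε ℚ.+ ½ ℚ.* ε ≡ ε
  halves = solve 1 (λ ε → con ½ :* ε :+ con ½ :* ε := ε) refl

  *-pos : ∀ {p q} → 0ℚ ℚ.< p → 0ℚ ℚ.< q → 0ℚ ℚ.< p ℚ.* q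
  *-pos {p} {q} 0<p 0<q =
    subst (ℚ._< p ℚ.* q) (ℚ.*-zeroʳ p) (ℚ.*-monoʳ-<-pos p ⦃ ℚ.positive 0<p ⦄ 0<q)

  *-mono-≤ : ∀ {p q r s} → 0ℚ ℚ.≤ p → 0ℚ ℚ.≤ s → p ℚ.≤ q → r ℚ.≤ s → p ℚ.* r ℚ.≤ q ℚ.* s
  *-mono-≤ {p} {q} {r} {s} 0≤p 0≤s p≤q r≤s = ℚ.≤-trans
    (ℚ.*-monoˡ-≤-nonNeg p ⦃ ℚ.nonNegative 0≤p ⦄ r≤s)
    (ℚ.*-monoʳ-≤-nonNeg s ⦃ ℚ.nonNegative 0≤s ⦄ p≤q)

  ∣p-q∣≡∣q-p∣ : ∀ p q → ℚ.∣ p ℚ.- q ∣ ≡ ℚ.∣ q ℚ.- p ∣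
  ∣p-q∣≡∣q-p∣ p q = trans (sym (ℚ.∣-p∣≡∣p∣ (p ℚ.- q)))
    (cong ℚ.∣_∣ (solve 2 (λ p q → :- (p :- q) := q :- p) refl p q))

  ∣p∣≤∣q∣+∣p-q∣ : ∀ p q → ℚ.∣ p ∣ ℚ.≤ ℚ.∣ q ∣ ℚ.+ ℚ.∣ p ℚ.- q ∣
  ∣p∣≤∣q∣+∣p-q∣ p q = subst (λ r → ℚ.∣ r ∣ ℚ.≤ ℚ.∣ q ∣ ℚ.+ ℚ.∣ p ℚ.- q ∣)
    (solve 2 (λ p q → q :+ (p :- q) := p) refl p q)
    (ℚ.∣p+q∣≤∣p∣+∣q∣ q (p ℚ.- q))

  +-minus-+ : ∀ a b c e → (a ℚ.+ b) ℚ.- (c ℚ.+ e) ≡ (a ℚ.- c) ℚ.+ (b ℚ.- e)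
  +-minus-+ = solve 4 (λ a b c e → (a :+ b) :- (c :+ e) := (a :- c) :+ (b :- e)) refl

  *-minus-* : ∀ a b c e → a ℚ.* b ℚ.- c ℚ.* e ≡ a ℚ.* (b ℚ.- e) ℚ.+ e ℚ.* (a ℚ.- c)
  *-minus-* = solve 4 (λ a b c e → a :* b :- c :* e := a :* (b :- e) :+ e :* (a :- c)) refl

  clear : ∀ a b r s → (r ℚ.- s) ℚ.* (a ℚ.* b) ≡ r ℚ.* a ℚ.* b ℚ.- s ℚ.* b ℚ.* a
  clear = solve 4 (λ a b r s → (r :- s) :* (a :* b) := r :* a :* b :- s :* b :* a) refl

fromℚ : ℚ → ℝ
fromℚ q = real (λ _ → q) (λ ε 0<ε → 0 , λ _ _ _ _ →
  subst (ℚ._< ε) (sym (cong ℚ.∣_∣ (ℚ.+-inverseʳ q))) 0<ε)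

0ᴿ 1ᴿ : ℝ
0ᴿ = fromℚ 0ℚ
1ᴿ = fromℚ 1ℚ

infixl 6 _+ᴿ_
infixl 7 _*ᴿ_

_+ᴿ_ : ℝ → ℝ → ℝ
seq (x +ᴿ y) n = seq x n ℚ.+ seq y n
cauchy (x +ᴿ y) ε 0<ε
  with cauchy x (½ ℚ.* ε) (half-pos 0<ε) | cauchy y (½ ℚ.* ε) (half-pos 0<ε)
... | M , hx | N , hy = M ℕ.⊔ N , λ m n M⊔N≤m M⊔N≤n → begin-strict
  ℚ.∣ (seq x m ℚ.+ seq y m) ℚ.- (seq x n ℚ.+ seq y n) ∣
    ≡⟨ cong ℚ.∣_∣ (+-minus-+ (seq x m) (seq y m) (seq x n) (seq y n)) ⟩
  ℚ.∣ (seq x m ℚ.- seq x n) ℚ.+ (seq y m ℚ.- seq y n) ∣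
    ≤⟨ ℚ.∣p+q∣≤∣p∣+∣q∣ (seq x m ℚ.- seq x n) (seq y m ℚ.- seq y n) ⟩
  ℚ.∣ seq x m ℚ.- seq x n ∣ ℚ.+ ℚ.∣ seq y m ℚ.- seq y n ∣
    <⟨ ℚ.+-mono-< (hx m n (ℕ.m⊔n≤o⇒m≤o M N M⊔N≤m) (ℕ.m⊔n≤o⇒m≤o M N M⊔N≤n))
                  (hy m n (ℕ.m⊔n≤o⇒n≤o M N M⊔N≤m) (ℕ.m⊔n≤o⇒n≤o M N M⊔N≤n)) ⟩
  ½ ℚ.* ε ℚ.+ ½ ℚ.* ε
    ≡⟨ halves ε ⟩
  ε ∎
  where open ℚ.≤-Reasoning

private
  bounded : ∀ x → ∃ λ B → 0ℚ ℚ.< B × ∃ λ N → ∀ n → N ℕ.≤ n → ℚ.∣ seq x n ∣ ℚ.≤ B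
  bounded x with cauchy x 1ℚ (ℚ.positive⁻¹ 1ℚ)
  ... | N , h =
    ℚ.∣ seq x N ∣ ℚ.+ 1ℚ ,
    ℚ.+-mono-≤-< (ℚ.0≤∣p∣ (seq x N)) (ℚ.positive⁻¹ 1ℚ) ,
    N , λ n N≤n → ℚ.≤-trans (∣p∣≤∣q∣+∣p-q∣ (seq x n) (seq x N))
      (ℚ.+-monoʳ-≤ ℚ.∣ seq x N ∣ (ℚ.<⇒≤ (h n N N≤n ℕ.≤-refl)))

  divide : ∀ ε B → 0ℚ ℚ.< ε → 0ℚ ℚ.< B → ∃ λ δ → 0ℚ ℚ.< δ × B ℚ.* δ ≡ ε
  divide ε B 0<ε 0<B = (ℚ.1/ B) ℚ.* ε , *-pos 0<1/B 0<ε ,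
    trans (sym (ℚ.*-assoc B (ℚ.1/ B) ε))
      (trans (cong (ℚ._* ε) (ℚ.*-inverseʳ B)) (ℚ.*-identityˡ ε))
    where
    instance
      B-pos = ℚ.positive 0<B
      B-nonZero = ℚ.pos⇒nonZero B
    0<1/B = ℚ.positive⁻¹ (ℚ.1/ B) ⦃ ℚ.1/pos⇒pos B ⦄

  half-< : ∀ {ε} → 0ℚ ℚ.< ε → ½ ℚ.* ε ℚ.< ε
  half-< {ε} 0<ε = subst₂ ℚ._<_ (ℚ.+-identityʳ (½ ℚ.* ε)) (halves ε)
    (ℚ.+-monoʳ-< (½ ℚ.* ε) (half-pos 0<ε))

  ∣*∣-≤ : ∀ p q P Q → ℚ.∣ p ∣ ℚ.≤ P → ℚ.∣ q ∣ ℚ.< Q → ℚ.∣ p ℚ.* q ∣ ℚ.≤ P ℚ.* Q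
  ∣*∣-≤ p q P Q ∣p∣≤P ∣q∣<Q = subst (ℚ._≤ P ℚ.* Q) (sym (ℚ.∣p*q∣≡∣p∣*∣q∣ p q))
    (*-mono-≤ {ℚ.∣ p ∣} {P} {ℚ.∣ q ∣} {Q} (ℚ.0≤∣p∣ p)
      (ℚ.≤-trans (ℚ.0≤∣p∣ q) (ℚ.<⇒≤ ∣q∣<Q)) ∣p∣≤P (ℚ.<⇒≤ ∣q∣<Q))

  *-close : ∀ a b c e A B α β → ℚ.∣ a ∣ ℚ.≤ A → ℚ.∣ e ∣ ℚ.≤ B →
            ℚ.∣ b ℚ.- e ∣ ℚ.< α → ℚ.∣ a ℚ.- c ∣ ℚ.< β →
            ℚ.∣ a ℚ.* b ℚ.- c ℚ.* e ∣ ℚ.≤ A ℚ.* α ℚ.+ B ℚ.* β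
  *-close a b c e A B α β ∣a∣≤A ∣e∣≤B ∣b-e∣<α ∣a-c∣<β =
    subst (λ r → ℚ.∣ r ∣ ℚ.≤ A ℚ.* α ℚ.+ B ℚ.* β) (sym (*-minus-* a b c e))
      (ℚ.≤-trans (ℚ.∣p+q∣≤∣p∣+∣q∣ (a ℚ.* (b ℚ.- e)) (e ℚ.* (a ℚ.- c)))
        (ℚ.+-mono-≤ (∣*∣-≤ a (b ℚ.- e) A α ∣a∣≤A ∣b-e∣<α)
                    (∣*∣-≤ e (a ℚ.- c) B β ∣e∣≤B ∣a-c∣<β)))

  *-cauchy : ∀ x y ε → 0ℚ ℚ.< ε → ∃ λ N → ∀ m n → N ℕ.≤ m → N ℕ.≤ n →
    ℚ.∣ seq x m ℚ.* seq y m ℚ.- seq x n ℚ.* seq y n ∣ ℚ.< ε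
  *-cauchy x y ε 0<ε =
    let (A , 0<A , K , ∣x∣≤A) = bounded x
        (B , 0<B , L , ∣y∣≤B) = bounded y
        ½ε    = ½ ℚ.* ε
        0<½ε  = half-pos 0<ε
        (α , 0<α , Aα≡¼ε) = divide (½ ℚ.* ½ε) A (half-pos 0<½ε) 0<A
        (β , 0<β , Bβ≡¼ε) = divide (½ ℚ.* ½ε) B (half-pos 0<½ε) 0<B
        (M , hx) = cauchy x β 0<β
        (N , hy) = cauchy y α 0<α
    in (K ℕ.⊔ L) ℕ.⊔ (M ℕ.⊔ N) , λ m n ≤m ≤n →
      let K⊔L≤m = ℕ.m⊔n≤o⇒m≤o (K ℕ.⊔ L) (M ℕ.⊔ N) ≤m
          K⊔L≤n = ℕ.m⊔n≤o⇒m≤o (K ℕ.⊔ L) (M ℕ.⊔ N) ≤n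
          M⊔N≤m = ℕ.m⊔n≤o⇒n≤o (K ℕ.⊔ L) (M ℕ.⊔ N) ≤m
          M⊔N≤n = ℕ.m⊔n≤o⇒n≤o (K ℕ.⊔ L) (M ℕ.⊔ N) ≤n
      in ℚ.≤-<-trans
        (*-close (seq x m) (seq y m) (seq x n) (seq y n) A B α β
          (∣x∣≤A m (ℕ.m⊔n≤o⇒m≤o K L K⊔L≤m))
          (∣y∣≤B n (ℕ.m⊔n≤o⇒n≤o K L K⊔L≤n))
          (hy m n (ℕ.m⊔n≤o⇒n≤o M N M⊔N≤m) (ℕ.m⊔n≤o⇒n≤o M N M⊔N≤n))
          (hx m n (ℕ.m⊔n≤o⇒m≤o M N M⊔N≤m) (ℕ.m⊔n≤o⇒m≤o M N M⊔N≤n)))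
        (subst (ℚ._< ε) (sym (trans (cong₂ ℚ._+_ Aα≡¼ε Bβ≡¼ε) (halves ½ε))) (half-< 0<ε))

_*ᴿ_ : ℝ → ℝ → ℝ
seq (x *ᴿ y) n = seq x n ℚ.* seq y n
cauchy (x *ᴿ y) = *-cauchy x y

-- Total on ℚ; a positive real is eventually bounded away from 0, so the
-- convention recip 0ℚ = 0ℚ affects only finitely many terms of its inverse.
recip : ℚ → ℚ
recip q with q ℚ.≟ 0ℚ
... | yes _   = 0ℚ
... | no q≢0 = (ℚ.1/ q) ⦃ ℚ.≢-nonZero q≢0 ⦄

recip-inverse : ∀ q → 0ℚ ℚ.< q → recip q ℚ.* q ≡ 1ℚ
recip-inverse q 0<q with q ℚ.≟ 0ℚ
... | yes refl = contradiction 0<q (ℚ.<-irrefl refl)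
... | no q≢0  = ℚ.*-inverseˡ q ⦃ ℚ.≢-nonZero q≢0 ⦄

infix 8 _⁻¹

_⁻¹ : ∀ x → 0ᴿ <ᴿ x → ℝ
seq ((x ⁻¹) _) n = recip (seq x n)
cauchy ((x ⁻¹) (δ , 0<δ , K , δ≤x)) ε 0<ε
  with cauchy x (ε ℚ.* (δ ℚ.* δ)) (*-pos 0<ε (*-pos 0<δ 0<δ))
... | M , h = K ℕ.⊔ M , λ m n ≤m ≤n →
  close (seq x m) (seq x n) (bound m (ℕ.m⊔n≤o⇒m≤o K M ≤m)) (bound n (ℕ.m⊔n≤o⇒m≤o K M ≤n))
    (h m n (ℕ.m⊔n≤o⇒n≤o K M ≤m) (ℕ.m⊔n≤o⇒n≤o K M ≤n))
  where
  bound : ∀ n → K ℕ.≤ n → δ ℚ.≤ seq x n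
  bound n K≤n = subst (ℚ._≤ seq x n) (ℚ.+-identityˡ δ) (δ≤x n K≤n)

  close : ∀ a b → δ ℚ.≤ a → δ ℚ.≤ b → ℚ.∣ a ℚ.- b ∣ ℚ.< ε ℚ.* (δ ℚ.* δ) →
          ℚ.∣ recip a ℚ.- recip b ∣ ℚ.< ε
  close a b δ≤a δ≤b ∣a-b∣<εδδ =
    ℚ.*-cancelʳ-<-nonNeg (a ℚ.* b) ⦃ ℚ.nonNegative 0≤ab ⦄ (begin-strict
      ℚ.∣ recip a ℚ.- recip b ∣ ℚ.* (a ℚ.* b)
        ≡⟨ cong (ℚ.∣ recip a ℚ.- recip b ∣ ℚ.*_) (sym (ℚ.0≤p⇒∣p∣≡p 0≤ab)) ⟩
      ℚ.∣ recip a ℚ.- recip b ∣ ℚ.* ℚ.∣ a ℚ.* b ∣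
        ≡⟨ sym (ℚ.∣p*q∣≡∣p∣*∣q∣ (recip a ℚ.- recip b) (a ℚ.* b)) ⟩
      ℚ.∣ (recip a ℚ.- recip b) ℚ.* (a ℚ.* b) ∣
        ≡⟨ cong ℚ.∣_∣ (clear a b (recip a) (recip b)) ⟩
      ℚ.∣ recip a ℚ.* a ℚ.* b ℚ.- recip b ℚ.* b ℚ.* a ∣
        ≡⟨ cong₂ (λ r s → ℚ.∣ r ℚ.* b ℚ.- s ℚ.* a ∣) (recip-inverse a 0<a) (recip-inverse b 0<b) ⟩
      ℚ.∣ 1ℚ ℚ.* b ℚ.- 1ℚ ℚ.* a ∣
        ≡⟨ cong₂ (λ r s → ℚ.∣ r ℚ.- s ∣) (ℚ.*-identityˡ b) (ℚ.*-identityˡ a) ⟩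
      ℚ.∣ b ℚ.- a ∣
        ≡⟨ ∣p-q∣≡∣q-p∣ b a ⟩
      ℚ.∣ a ℚ.- b ∣
        <⟨ ∣a-b∣<εδδ ⟩
      ε ℚ.* (δ ℚ.* δ)
        ≤⟨ ℚ.*-monoˡ-≤-nonNeg ε ⦃ ℚ.nonNegative (ℚ.<⇒≤ 0<ε) ⦄
             (*-mono-≤ (ℚ.<⇒≤ 0<δ) (ℚ.<⇒≤ 0<b) δ≤a δ≤b) ⟩
      ε ℚ.* (a ℚ.* b) ∎)
    where
    open ℚ.≤-Reasoning
    0<a = ℚ.<-≤-trans 0<δ δ≤a
    0<b = ℚ.<-≤-trans 0<δ δ≤b
    0≤ab = ℚ.<⇒≤ (*-pos 0<a 0<b)

∑ : List ℝ → ℝ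
∑ = foldr _+ᴿ_ 0ᴿ

infix 4 _⟶_

-- ∣ x k - y ∣ < ε, written as a two-sided bound.
_⟶_ : (ℕ → ℝ) → ℝ → Set
x ⟶ y = ∀ ε → 0ℚ ℚ.< ε → ∃ λ K → ∀ k → K ℕ.≤ k →
  x k <ᴿ y +ᴿ fromℚ ε × y <ᴿ x k +ᴿ fromℚ ε

------------------------------------------------------------------------
-- Markov chains on the Young lattice

-- Only the values p μ ν with μ a state carry meaning; p is total so that
-- no proof of State μ has to be passed around.
record MarkovChain : Set₁ where
  field
    State    : Partition → Set
    p        : Partition → Partition → ℝ
    start    : State ∅
    p-nonneg : ∀ {μ} ν → State μ → 0ᴿ ≤ᴿ p μ ν
    p-edges  : ∀ {μ ν} → State μ → ¬ (μ ↗ ν) → p μ ν ≈ 0ᴿ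
    p-sum    : ∀ {μ} → State μ → ∑ (map (λ (ν , _) → p μ ν) (up μ)) ≈ 1ᴿ
    p-closed : ∀ {μ ν} → State μ → 0ᴿ <ᴿ p μ ν → State ν

open MarkovChain public

infix 4 _≋_

-- Same state space and same transition probabilities; the starting point
-- is ∅ for every chain.
_≋_ : MarkovChain → MarkovChain → Set
C ≋ D = (∀ μ → State C μ ⇔ State D μ) ×
        (∀ {μ} ν → State C μ → p C μ ν ≈ p D μ ν)

pathProb : MarkovChain → ∀ {μ ν} → μ ⇝ ν → ℝ
pathProb C done                      = 1ᴿ
pathProb C (_◅_ {i = μ} {j = κ} _ w) = p C μ κ *ᴿ pathProb C w

-- ℙ C n ν is the probability that the chain is at ν at time n.
ℙ : MarkovChain → ℕ → Partition → ℝ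
ℙ C n ν = ∑ (map (pathProb C) (walks n ∅ ν))

Harmonic : (Partition → ℝ) → Set
Harmonic h = h ∅ ≈ 1ᴿ × (∀ μ → h μ ≈ ∑ (map (λ (ν , _) → h ν) (up μ)))

record _DrivenBy_ (C : MarkovChain) (h : Partition → ℝ) : Set where
  field
    support : ∀ μ → State C μ ⇔ 0ᴿ <ᴿ h μ
    ratio   : ∀ {μ ν} → μ ↗ ν → (0<h : 0ᴿ <ᴿ h μ) → p C μ ν ≈ h ν *ᴿ (h μ ⁻¹) 0<h

------------------------------------------------------------------------
-- Maximal entropy random walks

φ : ℕ → Partition → ℚ
φ n μ = (+ d𝕐 μ n ℚ./ d𝕐 ∅ n) ⦃ d∅𝕐-nonZero n ⦄

IsSubsequentialLimit : (Partition → ℝ) → Set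
IsSubsequentialLimit h = ∃ λ (σ : ℕ → ℕ) →
  (∀ k → σ k ℕ.< σ (suc k)) × (∀ μ → (λ k → fromℚ (φ (σ k) μ)) ⟶ h μ)

IsMERW : MarkovChain → Set
IsMERW C = ∃ λ φ* → IsSubsequentialLimit φ* × C DrivenBy φ*

------------------------------------------------------------------------
-- The Plancherel growth process

plancherel : Partition → ℝ
plancherel μ = fromℚ ((+ d ∅ μ ℚ./ size μ !) ⦃ ℕ._!≢0 (size μ) ⦄)

IsPlancherelGrowth : MarkovChain → Set
IsPlancherelGrowth C = Harmonic plancherel × C DrivenBy plancherel

HasPlancherelMarginals : MarkovChain → Set
HasPlancherelMarginals C = ∀ μ →
  ℙ C (size μ) μ ≈ fromℚ ((+ (d ∅ μ ℕ.^ 2) ℚ./ size μ !) ⦃ ℕ._!≢0 (size μ) ⦄)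

HasPlancherelTransitions : MarkovChain → Set
HasPlancherelTransitions C = ∀ {μ ν} → State C μ → μ ↗ ν →
  p C μ ν ≈ fromℚ ((+ d ∅ ν ℚ./ (suc (size μ) ℕ.* d ∅ μ))
    ⦃ ℕ.m*n≢0 (suc (size μ)) (d ∅ μ) ⦃ _ ⦄ ⦃ d∅-nonZero μ ⦄ ⦄)

{-# OPTIONS --safe #-}

-- Let A and B act on functions on partitions by summing over the upper,
-- respectively lower, neighbours. Then AB − BA = 1 and A1 = B1 + 1, so the
-- number a k μ of upward walks of length k from μ satisfies
--   a (k + 2) = a (k + 1) + (k + 1) a k + B (a (k + 1)).
-- Solving this recurrence gives, for t k = a k ∅ (the involution numbers),
--   a k μ = Σ_j C(k, j) t (k − j) (B^j 1)(μ),   0 ≤ j ≤ |μ|.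
-- Since t (m + 1) / t m → ∞ and t (m + 2) ~ m t m, dividing by t (k + |μ|)
-- kills every term but j = |μ|, and (B^|μ| 1)(μ) = d(∅, μ). Hence φ_n(μ)
-- converges to d(∅, μ) / |μ|! along the full sequence of n, and every MERW is
-- driven by this one function. Harmonicity, A f = (n + 1) f for f = d(∅, ·), also
-- comes from AB − BA = 1, and the marginals telescope along paths.
module Submission where

open import Algebra.Properties.CommutativeSemigroup using (interchange)
open import Data.Bool.Base using (Bool; true; false; if_then_else_)
open import Data.Bool.Properties using (T-≡)
open import Data.Integer.Base as ℤ using (+[1+_]) renaming (+_ to pos)
import Data.Integer.Properties as ℤ
open import Data.List.Base using (List; []; _∷_; map; mapMaybe; concat; length; foldr)
import Data.List.Membership.DecPropositional as DecMembership
open import Data.List.Membership.Propositional using (_∈_)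
open import Data.List.Membership.Propositional.Properties using (∈-map⁺; ∈-map⁻)
import Data.List.Properties as List
open import Data.List.Relation.Unary.All as All using (All; []; _∷_)
open import Data.List.Relation.Unary.AllPairs using ([]; _∷_)
open import Data.List.Relation.Unary.Any using (here; there)
open import Data.List.Relation.Unary.Linked as Linked using (Linked; []; [-]; _∷_)
open import Data.List.Relation.Unary.Unique.Propositional using (Unique)
open import Data.Nat.Base as ℕ
  using (ℕ; zero; suc; _+_; _*_; _∸_; _^_; _⊔_; _!; _<_; _≤_; _≥_; _<ᵇ_; _≡ᵇ_; _≤′_; ≤′-refl; ≤′-step; z≤n; s≤s)
open import Data.Nat.ListAction using (sum)
import Data.Nat.Properties as ℕ
open import Data.Nat.Tactic.RingSolver using (solve-∀)
open import Data.Product using (∃; ∃₂; _×_; _,_; proj₁; proj₂)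
open import Data.Rational.Base as ℚ using (ℚ; 0ℚ; 1ℚ; ½; mkℚ)
import Data.Rational.Properties as ℚ
open import Data.Rational.Solver using (module +-*-Solver)
import Data.Rational.Unnormalised.Base as ℚᵘ
import Data.Rational.Unnormalised.Properties as ℚᵘ
open import Data.Sum.Base using (inj₁; inj₂)
open import Data.Unit.Base using (⊤; tt)
open import Function.Base using (_∘_; const; id; case_of_)
open import Function.Bundles using (_⇔_; mk⇔; Equivalence)
open import Relation.Binary.Construct.Closure.ReflexiveTransitive using (_◅_) renaming (ε to done)
open import Relation.Binary.PropositionalEquality
open import Relation.Nullary using (¬_; Dec; yes; no; contradiction; recompute)
import Relation.Nullary.Decidable as Dec
open +-*-Solver using (_:=_; _:+_; _:-_; :-_; _:*_; con) renaming (solve to solveℚ)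
open import Defs

-- Rows and boxes

-- The expansion of `a k` is the coefficient form of e^(xA) 1 = e^(x + x²/2) e^(xB) 1. Both sides
-- solve F' = (1 + x + B) F with F(0) = 1, because moving A past e^(xB) produces a factor x and A1 =
-- B1 + 1. The scalar factor e^(x + x²/2) is the exponential generating function of the involution
-- numbers. The commutation relation is proved by recursion on the rows. The tail of a diagram is
-- not an arbitrary partition but one confined by the row above it, so the operators and shapes
-- carry a condition on the first row, and the relation has to be generalised to all such
-- conditions. Counting stays in ℕ: identities with a difference are stated with a term on each
-- side.

+-interchange : ∀ a b c d → (a + b) + (c + d) ≡ (a + c) + (b + d)
+-interchange = interchange ℕ.+-commutativeSemigroup

when : Bool → ℕ → ℕ
when b n = if b then n else 0

when-0 : ∀ b → when b 0 ≡ 0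
when-0 true  = refl
when-0 false = refl

when-+ : ∀ b m n → when b (m + n) ≡ when b m + when b n
when-+ true  m n = refl
when-+ false m n = refl

when-* : ∀ b m n → when b (m * n) ≡ m * when b n
when-* true  m n = refl
when-* false m n = sym (ℕ.*-zeroʳ m)

hd : List ℕ → ℕ
hd []      = 0
hd (x ∷ _) = x

-- c x says that a first row of length x may be extended.
Up : (ℕ → Bool) → (List ℕ → ℕ) → List ℕ → ℕ
Up c g []       = when (c 0) (g (1 ∷ []))
Up c g (x ∷ xs) = when (c x) (g (suc x ∷ xs)) + Up (_<ᵇ x) (g ∘ (x ∷_)) xs

-- A row that loses its only box disappears. Dropping the tail as well is harmless in `Down`: the
-- guard `hd xs <ᵇ 1` then admits only shapes without further rows.
shrink : ℕ → List ℕ → List ℕ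
shrink zero    _  = []
shrink (suc k) xs = suc k ∷ xs

Down : (List ℕ → ℕ) → List ℕ → ℕ
Down g []           = 0
Down g (zero ∷ _)   = 0
Down g (suc k ∷ xs) =
  when (hd xs <ᵇ suc k) (g (shrink k xs)) + Down (g ∘ (suc k ∷_)) xs

-- The partitions whose first row arises by an extension that c allows.
data Shape (c : ℕ → Bool) : List ℕ → Set where
  []  : Shape c []
  _∷_ : ∀ {k xs} → c k ≡ true → Shape (_<ᵇ suc k) xs → Shape c (suc k ∷ xs)

anyRow : ℕ → Bool
anyRow _ = true

-- Removing a box from the first row lowers the argument of `c` by one, and the result must still be
-- a `Shape c`.
Closed : (ℕ → Bool) → Set
Closed c = ∀ z → c (suc z) ≡ true → c z ≡ true

<ᵇ-closed : ∀ b → Closed (_<ᵇ b)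
<ᵇ-closed (suc b)       zero    _ = refl
<ᵇ-closed (suc (suc b)) (suc z) p = <ᵇ-closed (suc b) z p

<ᵇ-suc : ∀ z b → (z <ᵇ b) ≡ true → (z <ᵇ suc b) ≡ true
<ᵇ-suc zero    b       _ = refl
<ᵇ-suc (suc z) (suc b) p = <ᵇ-suc z b p

Shape-mono : ∀ {c c′ xs} → (∀ z → c z ≡ true → c′ z ≡ true) → Shape c xs → Shape c′ xs
Shape-mono c⇒c′ []      = []
Shape-mono c⇒c′ (p ∷ s) = c⇒c′ _ p ∷ s

hd<ᵇ : ∀ {k xs} → Shape (_<ᵇ suc k) xs → (hd xs <ᵇ suc (suc k)) ≡ true
hd<ᵇ []      = refl
hd<ᵇ (p ∷ _) = p

below : ∀ {x xs} → Linked _≥_ (x ∷ xs) → All (1 ≤_) xs → Shape (_<ᵇ x) xs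
below [-] [] = []
below {x} {suc k ∷ xs} (x≥y ∷ l) (s≤s z≤n ∷ a) =
  Dec.dec-true (k ℕ.<? x) x≥y ∷ below l a

IsPartition⇒Shape : ∀ {xs} → IsPartition xs → Shape anyRow xs
IsPartition⇒Shape {[]}         _ = []
IsPartition⇒Shape {suc x ∷ xs} (l , _ ∷ a) = refl ∷ below l a
IsPartition⇒Shape {zero ∷ xs}  (_ , () ∷ _)

Shape⇒IsPartition : ∀ {c xs} → Shape c xs → IsPartition xs
Shape⇒IsPartition s = linked s , positive s
  where
  positive : ∀ {c xs} → Shape c xs → All (1 ≤_) xs
  positive []      = []
  positive (_ ∷ s) = s≤s z≤n ∷ positive s

  linked : ∀ {c xs} → Shape c xs → Linked _≥_ xs
  linked []          = []
  linked (_ ∷ [])    = [-]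
  linked {xs = suc k ∷ suc l ∷ _} (_ ∷ p ∷ s) =
    ℕ.<ᵇ⇒< l (suc k) (Equivalence.from T-≡ p) ∷ linked {_<ᵇ suc k} (p ∷ s)

Up-cong : ∀ {c xs g h} → Shape c xs →
  (∀ ys → Shape c ys → sum ys ≡ suc (sum xs) → g ys ≡ h ys) → Up c g xs ≡ Up c h xs
Up-cong {c} [] eq with c 0 in c0
... | true  = eq _ (c0 ∷ []) refl
... | false = refl
Up-cong {c} {suc k ∷ xs} {g} {h} (p ∷ s) eq = cong₂ _+_ first
  (Up-cong s λ ys t e → eq _ (p ∷ t) (trans (cong (suc k +_) e) (ℕ.+-suc (suc k) _)))
  where
  first : when (c (suc k)) (g (suc (suc k) ∷ xs)) ≡ when (c (suc k)) (h (suc (suc k) ∷ xs))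
  first with c (suc k) in ck
  ... | true  = eq _ (ck ∷ Shape-mono (λ z → <ᵇ-suc z (suc k)) s) refl
  ... | false = refl

Down-cong : ∀ {c xs g h} → Closed c → Shape c xs →
  (∀ ys → Shape c ys → sum xs ≡ suc (sum ys) → g ys ≡ h ys) → Down g xs ≡ Down h xs
Down-cong cl [] eq = refl
Down-cong {c} {suc k ∷ xs} {g} {h} cl (p ∷ s) eq = cong₂ _+_ (first k p s eq)
  (Down-cong (<ᵇ-closed (suc k)) s
    λ ys t e → eq _ (p ∷ t) (trans (cong (suc k +_) e) (ℕ.+-suc (suc k) _)))
  where
  last : ∀ {k xs} → Shape (_<ᵇ suc k) xs → (hd xs <ᵇ suc k) ≡ true → Shape (_<ᵇ k) xs
  last []      _ = []
  last (p ∷ s) q = q ∷ s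

  first : ∀ k {xs} → c k ≡ true → Shape (_<ᵇ suc k) xs →
    (∀ ys → Shape c ys → sum (suc k ∷ xs) ≡ suc (sum ys) → g ys ≡ h ys) →
    when (hd xs <ᵇ suc k) (g (shrink k xs)) ≡ when (hd xs <ᵇ suc k) (h (shrink k xs))
  first zero    p []      eq = eq _ [] refl
  first zero    p (_ ∷ _) eq = refl
  first (suc k) {xs} p s eq with hd xs <ᵇ suc (suc k) in q
  ... | false = refl
  ... | true  = eq _ (cl k p ∷ last s q) refl

Up-+ : ∀ c g h xs → Up c (λ ys → g ys + h ys) xs ≡ Up c g xs + Up c h xs
Up-+ c g h []       = when-+ (c 0) _ _
Up-+ c g h (x ∷ xs) = trans
  (cong₂ _+_ (when-+ (c x) _ _) (Up-+ _ (g ∘ (x ∷_)) (h ∘ (x ∷_)) xs))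
  (+-interchange (when (c x) (g _)) _ (Up _ (g ∘ (x ∷_)) xs) _)

Up-0 : ∀ c xs → Up c (const 0) xs ≡ 0
Up-0 c []       = when-0 (c 0)
Up-0 c (x ∷ xs) = cong₂ _+_ (when-0 (c x)) (Up-0 _ xs)

Down-+ : ∀ g h xs → Down (λ ys → g ys + h ys) xs ≡ Down g xs + Down h xs
Down-+ g h []           = refl
Down-+ g h (zero ∷ xs)  = refl
Down-+ g h (suc k ∷ xs) = trans
  (cong₂ _+_ (when-+ (hd xs <ᵇ suc k) _ _) (Down-+ (g ∘ (suc k ∷_)) (h ∘ (suc k ∷_)) xs))
  (+-interchange (when (hd xs <ᵇ suc k) (g _)) _ (Down (g ∘ (suc k ∷_)) xs) _)

Down-* : ∀ m g xs → Down (λ ys → m * g ys) xs ≡ m * Down g xs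
Down-* m g []           = sym (ℕ.*-zeroʳ m)
Down-* m g (zero ∷ xs)  = sym (ℕ.*-zeroʳ m)
Down-* m g (suc k ∷ xs) = trans
  (cong₂ _+_ (when-* (hd xs <ᵇ suc k) m _) (Down-* m (g ∘ (suc k ∷_)) xs))
  (sym (ℕ.*-distribˡ-+ m _ _))

Down-0 : ∀ xs → Down (const 0) xs ≡ 0
Down-0 = Down-* 0 (const 0)

Down-when : ∀ b g xs → Down (λ ys → when b (g ys)) xs ≡ when b (Down g xs)
Down-when true  g xs = refl
Down-when false g xs = Down-0 xs

-- Extending the first row `y` turns the inner guard into `suc y <ᵇ suc w`, which computes to
-- `y <ᵇ w`; a box added further down leaves the guard as it was.
Up-bounded : ∀ w f ys →
  Up (_<ᵇ suc w) (λ zs → when (hd zs <ᵇ suc w) (f zs)) ys ≡ when (hd ys <ᵇ suc w) (Up (_<ᵇ w) f ys)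
Up-bounded w f []       = refl
Up-bounded w f (y ∷ ys) with y <ᵇ suc w
... | true  = refl
... | false = Up-0 _ ys

Up-shrink : ∀ {k g c} ys → c k ≡ true → Shape (_<ᵇ suc k) ys →
  when (hd ys <ᵇ suc k) (g (suc k ∷ ys) + Up (_<ᵇ k) (g ∘ shrink k) ys) ≡
  when (hd ys <ᵇ suc k) (Up c g (shrink k ys))
Up-shrink {zero}  {g} []       p s rewrite p = ℕ.+-identityʳ (g (1 ∷ []))
Up-shrink {zero}      (_ ∷ ys) p (_ ∷ _) = refl
Up-shrink {suc k}     ys       p s rewrite p = refl

-- The relation DU − UD = I. Adding a box below the first row and then removing
-- one from the first row (or the reverse) is possible exactly when the second
-- row is short enough, which is what Up-bounded accounts for.
Up-Down : ∀ {c xs} g → Shape c xs → Up c (Down g) xs ≡ when (c (hd xs)) (g xs) + Down (Up c g) xs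
Up-Down {c} g [] = trans (cong (when (c 0)) (ℕ.+-identityʳ (g []))) (sym (ℕ.+-identityʳ _))
Up-Down {c} {suc k ∷ ys} g (p ∷ s) = begin
  when (c (suc k)) (when (hd ys <ᵇ suc (suc k)) G + D₂) + Up b (λ zs → Down g (suc k ∷ zs)) ys
    ≡⟨ cong₂ (λ t u → when (c (suc k)) (when t G + D₂) + u) (hd<ᵇ s)
         (Up-+ b (λ zs → when (hd zs <ᵇ suc k) (g (shrink k zs))) (Down g₁) ys) ⟩
  when (c (suc k)) (G + D₂) + (Up b (λ zs → when (hd zs <ᵇ suc k) (g (shrink k zs))) ys + Up b (Down g₁) ys)
    ≡⟨ cong₂ _+_ (when-+ (c (suc k)) G D₂)
         (cong₂ _+_ (Up-bounded k (g ∘ shrink k) ys) (Up-Down g₁ s)) ⟩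
  (cG + cD) + (when q X + (when q G + Down (Up b g₁) ys))
    ≡⟨ ℕ.+-assoc cG cD _ ⟩
  cG + (cD + (when q X + (when q G + Down (Up b g₁) ys)))
    -- `when q G` is the identity term of the induction hypothesis for the tail. It is regrouped as
    -- the term in which the first row loses a box and regains it, so that only `cG` remains as
    -- identity term of the whole diagram.
    ≡⟨ cong (cG +_) (rearrange cD (when q X) (when q G) (Down (Up b g₁) ys)) ⟩
  cG + ((when q G + when q X) + (cD + Down (Up b g₁) ys))
    ≡⟨ cong (λ t → cG + (t + (cD + Down (Up b g₁) ys)))
         (trans (sym (when-+ q G X)) (Up-shrink ys p s)) ⟩
  cG + (when q (Up c g (shrink k ys)) + (cD + Down (Up b g₁) ys))
    ≡⟨ cong (λ t → cG + (when q (Up c g (shrink k ys)) + (t + Down (Up b g₁) ys)))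
         (sym (Down-when (c (suc k)) (g ∘ (suc (suc k) ∷_)) ys)) ⟩
  cG + (when q (Up c g (shrink k ys)) + (Down (λ zs → when (c (suc k)) (g (suc (suc k) ∷ zs))) ys + Down (Up b g₁) ys))
    ≡⟨ cong (λ t → cG + (when q (Up c g (shrink k ys)) + t))
         (sym (Down-+ (λ zs → when (c (suc k)) (g (suc (suc k) ∷ zs))) (Up b g₁) ys)) ⟩
  cG + (when q (Up c g (shrink k ys)) + Down (Up c g ∘ (suc k ∷_)) ys) ∎
  where
  open ≡-Reasoning
  b  = _<ᵇ suc k
  g₁ = g ∘ (suc k ∷_)
  G  = g (suc k ∷ ys)
  D₂ = Down (g ∘ (suc (suc k) ∷_)) ys
  q  = hd ys <ᵇ suc k
  X  = Up (_<ᵇ k) (g ∘ shrink k) ys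
  cG = when (c (suc k)) G
  cD = when (c (suc k)) D₂

  rearrange : ∀ d x g e → d + (x + (g + e)) ≡ (g + x) + (d + e)
  rearrange = solve-∀

-- A row can be extended exactly when the row above it can lose a box. Pairing these moves leaves
-- only the extension of the first row unmatched.
Up-1 : ∀ {c xs} → Shape c xs → Up c (const 1) xs ≡ when (c (hd xs)) 1 + Down (const 1) xs
Up-1 {c} []      = sym (ℕ.+-identityʳ _)
Up-1 {c} {suc k ∷ xs} (_ ∷ s) = cong (when (c (suc k)) 1 +_) (Up-1 s)

δ : List ℕ → List ℕ → ℕ
δ []       []       = 1
δ (x ∷ xs) (y ∷ ys) = when (x ≡ᵇ y) (δ xs ys)
δ _        _        = 0

δ-hd : ∀ {k xs} → Shape (_<ᵇ suc k) xs → ∀ zs →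
  when (hd zs <ᵇ suc (suc k)) (δ xs zs) ≡ δ xs zs
δ-hd []      []       = refl
δ-hd {k} []      (z ∷ zs) = when-0 (z <ᵇ suc (suc k))
δ-hd (_ ∷ _) []       = refl
δ-hd {k} (_∷_ {l} p s) (z ∷ zs) with suc l ≡ᵇ z in e
... | false = when-0 (z <ᵇ suc (suc k))
... | true rewrite sym (ℕ.≡ᵇ⇒≡ (suc l) z (Equivalence.from T-≡ e)) | p = refl

-- Adding a box to `xs` gives `zs` exactly when removing one from `zs` gives `xs`: the two operators
-- are transposes of each other. This is the one-step case of reading walks from their far end.
Up-δ : ∀ {c c′ xs zs} → Shape c′ xs → Shape c zs →
  Up c (λ ys → δ ys zs) xs ≡ Down (δ xs) zs
Up-δ {c} [] [] = when-0 (c 0)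
Up-δ {c} [] (_∷_ {zero}  {[]}     p s) rewrite p = refl
Up-δ {c} [] (_∷_ {zero}  {z ∷ zs} p (_ ∷ _)) rewrite p = sym (Down-0 (z ∷ zs))
Up-δ {c} [] (_∷_ {suc k} {zs} p s) =
  trans (when-0 (c 0)) (sym (cong₂ _+_ (when-0 (hd zs <ᵇ suc (suc k))) (Down-0 zs)))
Up-δ {c} (_∷_ {k} {xs} _ _) [] = cong₂ _+_ (when-0 (c (suc k))) (Up-0 _ xs)
Up-δ {c} (_∷_ {k} {xs} _ s) (_∷_ {l} {zs} p t) = cong₂ _+_ (first l p) rest
  where
  first : ∀ l → c l ≡ true →
    when (c (suc k)) (when (suc k ≡ᵇ l) (δ xs zs)) ≡
    when (hd zs <ᵇ suc l) (δ (suc k ∷ xs) (shrink l zs))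
  first zero    p = trans (when-0 (c (suc k))) (sym (when-0 (hd zs <ᵇ 1)))
  first (suc l) p with k ≡ᵇ l in e
  ... | false = trans (when-0 (c (suc k))) (sym (when-0 (hd zs <ᵇ suc (suc l))))
  ... | true rewrite sym (ℕ.≡ᵇ⇒≡ k l (Equivalence.from T-≡ e)) | p = sym (δ-hd s zs)

  rest : Up (_<ᵇ suc k) (λ ys → when (k ≡ᵇ l) (δ ys zs)) xs ≡
         Down (λ ys → when (k ≡ᵇ l) (δ xs ys)) zs
  rest with k ≡ᵇ l in e
  ... | false = trans (Up-0 _ xs) (sym (Down-0 zs))
  ... | true rewrite ℕ.≡ᵇ⇒≡ k l (Equivalence.from T-≡ e) = Up-δ s t

-- The operators A and B on functions on partitions

extend : (Partition → ℕ) → List ℕ → ℕ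
extend G xs with isPartition? xs
... | yes p = G (partition xs p)
... | no  _ = 0

extend-rows : ∀ G μ → extend G (rows μ) ≡ G μ
extend-rows G (partition xs v) with isPartition? xs
... | yes _ = refl
... | no ¬p = contradiction (recompute (isPartition? xs) v) ¬p

extend-invalid : ∀ G {xs} → ¬ IsPartition xs → extend G xs ≡ 0
extend-invalid G {xs} ¬p with isPartition? xs
... | yes p = contradiction p ¬p
... | no _  = refl

extend-Shape : ∀ G {xs} (s : Shape anyRow xs) →
  extend G xs ≡ G (partition xs (Shape⇒IsPartition s))
extend-Shape G {xs} s = extend-rows G (partition xs (Shape⇒IsPartition s))

shape : ∀ μ → Shape anyRow (rows μ)
shape (partition xs v) = IsPartition⇒Shape (recompute (isPartition? xs) v)

A : (Partition → ℕ) → Partition → ℕ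
A G μ = sum (map (G ∘ proj₁) (up μ))

B : (Partition → ℕ) → Partition → ℕ
B G μ = Down (extend G) (rows μ)

sum-toEdge : ∀ G {μ} (bs : List (∃ (AddBox (rows μ)))) →
  sum (map (G ∘ proj₁) (mapMaybe (toEdge {μ}) bs)) ≡ sum (map (extend G ∘ proj₁) bs)
sum-toEdge G [] = refl
sum-toEdge G {μ} ((ys , b) ∷ bs) with isPartition? ys
... | yes p = cong (_ +_) (sum-toEdge G {μ} bs)
... | no  _ = sum-toEdge G {μ} bs

extendTail : ∀ {x xs} → ∃ (AddBox xs) → ∃ (AddBox (x ∷ xs))
extendTail (ys , b) = _ ∷ ys , there b

-- `addBoxes` also lists additions that break the order of the rows. As `g` vanishes on these, they
-- can be traded for the guards of `Up`; `b` is the length of the row above.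
sum-addBoxes-below : ∀ b (g : List ℕ → ℕ) → (∀ ys → ¬ Linked _≥_ (b ∷ ys) → g ys ≡ 0) → ∀ xs →
  sum (map (g ∘ proj₁) (addBoxes xs)) ≡ Up (_<ᵇ b) g xs
sum-addBoxes-below zero    g g0 [] = trans (ℕ.+-identityʳ _) (g0 _ λ { (() ∷ _) })
sum-addBoxes-below (suc b) g g0 [] = ℕ.+-identityʳ _
sum-addBoxes-below b g g0 (x ∷ xs) = cong₂ _+_ first
  (trans (cong sum (sym (List.map-∘ {g = g ∘ proj₁} {f = extendTail} (addBoxes xs))))
    (sum-addBoxes-below x (g ∘ (x ∷_)) (λ ys ¬l → g0 (x ∷ ys) (¬l ∘ Linked.tail)) xs))
  where
  first : g (suc x ∷ xs) ≡ when (x <ᵇ b) (g (suc x ∷ xs))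
  first with x <ᵇ b in e
  ... | true  = refl
  ... | false = g0 _ λ { (b≥ ∷ _) →
    contradiction (trans (sym e) (Dec.dec-true (x ℕ.<? b) b≥)) λ () }

sum-addBoxes : ∀ (g : List ℕ → ℕ) → (∀ ys → ¬ IsPartition ys → g ys ≡ 0) → ∀ xs →
  sum (map (g ∘ proj₁) (addBoxes xs)) ≡ Up anyRow g xs
sum-addBoxes g g0 []       = ℕ.+-identityʳ _
sum-addBoxes g g0 (x ∷ xs) = cong (g (suc x ∷ xs) +_)
  (trans (cong sum (sym (List.map-∘ {g = g ∘ proj₁} {f = extendTail} (addBoxes xs))))
    (sum-addBoxes-below x (g ∘ (x ∷_)) (λ ys ¬l → g0 (x ∷ ys) (¬l ∘ proj₁)) xs))

A-Up : ∀ G μ → A G μ ≡ Up anyRow (extend G) (rows μ)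
A-Up G μ = trans (sum-toEdge G {μ} (addBoxes (rows μ)))
  (sum-addBoxes (extend G) (λ _ → extend-invalid G) (rows μ))

B-cong : ∀ {G H : Partition → ℕ} μ → (∀ κ → size μ ≡ suc (size κ) → G κ ≡ H κ) → B G μ ≡ B H μ
B-cong {G} {H} μ eq = Down-cong (λ _ _ → refl) (shape μ) λ ys s e →
  trans (extend-Shape G s) (trans (eq _ e) (sym (extend-Shape H s)))

extend-ext : ∀ {G : Partition → ℕ} (g : List ℕ → ℕ) → (∀ μ → G μ ≡ g (rows μ)) →
  ∀ {xs} → Shape anyRow xs → extend G xs ≡ g xs
extend-ext {G} g eq s = trans (extend-Shape G s) (eq (partition _ (Shape⇒IsPartition s)))

B-Down : ∀ {G : Partition → ℕ} (g : List ℕ → ℕ) μ → (∀ κ → G κ ≡ g (rows κ)) → B G μ ≡ Down g (rows μ)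
B-Down g μ eq = Down-cong (λ _ _ → refl) (shape μ) λ ys s _ → extend-ext g eq s

A-Up′ : ∀ {G : Partition → ℕ} (g : List ℕ → ℕ) μ → (∀ κ → G κ ≡ g (rows κ)) → A G μ ≡ Up anyRow g (rows μ)
A-Up′ {G} g μ eq = trans (A-Up G μ) (Up-cong (shape μ) λ ys s _ → extend-ext g eq s)

A-cong : ∀ {G H : Partition → ℕ} μ → (∀ ν → size ν ≡ suc (size μ) → G ν ≡ H ν) → A G μ ≡ A H μ
A-cong μ eq = cong sum (List.map-cong (λ (ν , e) → eq ν (↗-size e)) (up μ))

A-B : ∀ G μ → A (B G) μ ≡ G μ + B (A G) μ
A-B G μ = begin
  A (B G) μ
    ≡⟨ A-Up′ (Down (extend G)) μ (λ _ → refl) ⟩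
  Up anyRow (Down (extend G)) (rows μ)
    ≡⟨ Up-Down (extend G) (shape μ) ⟩
  extend G (rows μ) + Down (Up anyRow (extend G)) (rows μ)
    ≡⟨ cong₂ _+_ (extend-rows G μ) (sym (B-Down (Up anyRow (extend G)) μ (A-Up G))) ⟩
  G μ + B (A G) μ ∎
  where open ≡-Reasoning

A-1 : ∀ μ → A (const 1) μ ≡ 1 + B (const 1) μ
A-1 μ = trans (A-Up′ (const 1) μ (λ _ → refl))
  (trans (Up-1 (shape μ)) (cong suc (sym (B-Down (const 1) μ (λ _ → refl)))))

B-+ : ∀ G H μ → B (λ κ → G κ + H κ) μ ≡ B G μ + B H μ
B-+ G H μ = trans
  (Down-cong (λ _ _ → refl) (shape μ) λ ys s _ →
    trans (extend-Shape _ s) (sym (cong₂ _+_ (extend-Shape G s) (extend-Shape H s))))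
  (Down-+ (extend G) (extend H) (rows μ))

B-* : ∀ m G μ → B (λ κ → m * G κ) μ ≡ m * B G μ
B-* m G μ = trans
  (Down-cong (λ _ _ → refl) (shape μ) λ ys s _ →
    trans (extend-Shape _ s) (sym (cong (m *_) (extend-Shape G s))))
  (Down-* m (extend G) (rows μ))

B-0 : ∀ μ → B (const 0) μ ≡ 0
B-0 = B-* 0 (const 0)

B-∅ : ∀ G μ → size μ ≡ 0 → B G μ ≡ 0
B-∅ G μ |μ| = trans (B-cong μ (λ κ e′ → contradiction (trans (sym |μ|) e′) λ ())) (B-0 μ)

A-+ : ∀ G H μ → A (λ κ → G κ + H κ) μ ≡ A G μ + A H μ
A-+ G H μ = go (up μ)
  where
  go : ∀ (es : List (∃ (μ ↗_))) → sum (map (λ e → G (proj₁ e) + H (proj₁ e)) es) ≡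
              sum (map (G ∘ proj₁) es) + sum (map (H ∘ proj₁) es)
  go []       = refl
  go ((ν , _) ∷ es) = trans (cong (G ν + H ν +_) (go es)) (+-interchange (G ν) (H ν) _ _)

A-* : ∀ m G μ → A (λ κ → m * G κ) μ ≡ m * A G μ
A-* m G μ = go (up μ)
  where
  go : ∀ (es : List (∃ (μ ↗_))) → sum (map (λ e → m * G (proj₁ e)) es) ≡ m * sum (map (G ∘ proj₁) es)
  go []       = sym (ℕ.*-zeroʳ m)
  go ((ν , _) ∷ es) = trans (cong (m * G ν +_) (go es)) (sym (ℕ.*-distribˡ-+ m (G ν) _))

-- Here `A` and `B` act on different arguments, so in contrast to `A-B` they commute without a
-- correction term.
B-A : ∀ (F : Partition → Partition → ℕ) μ ν →
  B (λ κ → A (λ ρ → F ρ κ) μ) ν ≡ A (λ ρ → B (F ρ) ν) μ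
B-A F μ ν = go (up μ)
  where
  go : ∀ (es : List (∃ (μ ↗_))) → B (λ κ → sum (map (λ e → F (proj₁ e) κ) es)) ν ≡
    sum (map (λ e → B (F (proj₁ e)) ν) es)
  go []             = B-0 ν
  go ((ρ , _) ∷ es) = trans (B-+ (F ρ) _ ν) (cong (B (F ρ) ν +_) (go es))

-- Counting walks by their first and by their last step

W : ℕ → Partition → Partition → ℕ
W k μ ν = length (walks k μ ν)

δ-refl : ∀ xs → δ xs xs ≡ 1
δ-refl []       = refl
δ-refl (x ∷ xs) rewrite Equivalence.to T-≡ (ℕ.≡⇒≡ᵇ x x refl) = δ-refl xs

δ-≢ : ∀ {xs ys} → xs ≢ ys → δ xs ys ≡ 0
δ-≢ {[]}     {[]}     ≢ = contradiction refl ≢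
δ-≢ {[]}     {_ ∷ _}  ≢ = refl
δ-≢ {_ ∷ _}  {[]}     ≢ = refl
δ-≢ {x ∷ xs} {y ∷ ys} ≢ with x ≡ᵇ y in e
... | false = refl
... | true  = δ-≢ (≢ ∘ cong₂ _∷_ (ℕ.≡ᵇ⇒≡ x y (Equivalence.from T-≡ e)))

W-zero : ∀ μ ν → W 0 μ ν ≡ δ (rows μ) (rows ν)
W-zero μ ν with μ ≟ ν
... | yes refl = sym (δ-refl (rows μ))
... | no μ≢ν   = sym (δ-≢ {rows μ} {rows ν} λ { refl → μ≢ν refl })

length-concat : ∀ {X : Set} (xss : List (List X)) → length (concat xss) ≡ sum (map length xss)
length-concat []         = refl
length-concat (xs ∷ xss) = trans (List.length-++ xs) (cong (length xs +_) (length-concat xss))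

W-suc : ∀ k μ ν → W (suc k) μ ν ≡ A (λ κ → W k κ ν) μ
W-suc k μ ν = trans (length-concat (map _ (up μ)))
  (cong sum (trans (sym (List.map-∘ (up μ)))
    (List.map-cong (λ (κ , e) → List.length-map (e ◅_) (walks k κ ν)) (up μ))))

-- `walks` branches on the first step, while the recursion for `d ∅` needs the last one. Only the
-- one-step case is combinatorial; after it, first and last steps are exchanged by `B-A`.
W-last : ∀ k μ ν → W (suc k) μ ν ≡ B (W k μ) ν
W-last zero μ ν = begin
  W 1 μ ν                                       ≡⟨ W-suc 0 μ ν ⟩
  A (λ κ → W 0 κ ν) μ                           ≡⟨ A-Up′ (λ ys → δ ys (rows ν)) μ (λ κ → W-zero κ ν) ⟩
  Up anyRow (λ ys → δ ys (rows ν)) (rows μ)     ≡⟨ Up-δ (shape μ) (shape ν) ⟩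
  Down (δ (rows μ)) (rows ν)                    ≡⟨ B-Down (δ (rows μ)) ν (W-zero μ) ⟨
  B (W 0 μ) ν                                   ∎
  where open ≡-Reasoning
W-last (suc k) μ ν = begin
  W (suc (suc k)) μ ν               ≡⟨ W-suc (suc k) μ ν ⟩
  A (λ ρ → W (suc k) ρ ν) μ         ≡⟨ A-cong μ (λ ρ _ → W-last k ρ ν) ⟩
  A (λ ρ → B (W k ρ) ν) μ           ≡⟨ B-A (W k) μ ν ⟨
  B (λ κ → A (λ ρ → W k ρ κ) μ) ν   ≡⟨ B-cong ν (λ κ _ → sym (W-suc k μ κ)) ⟩
  B (W (suc k) μ) ν                 ∎
  where open ≡-Reasoning

f : Partition → ℕ
f = d ∅

f-B : ∀ {n} μ → size μ ≡ suc n → f μ ≡ B f μ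
f-B {n} μ e = begin
  f μ              ≡⟨ cong (λ m → W m ∅ μ) e ⟩
  W (suc n) ∅ μ    ≡⟨ W-last n ∅ μ ⟩
  B (W n ∅) μ      ≡⟨ B-cong μ (λ κ e′ → cong (λ m → W m ∅ κ) (ℕ.suc-injective (trans (sym e) e′))) ⟩
  B f μ            ∎
  where open ≡-Reasoning

f-zero : ∀ μ → size μ ≡ 0 → f μ ≡ 1
f-zero (partition [] _) _ = refl
f-zero (partition (suc _ ∷ _) _) ()
f-zero (partition (zero ∷ xs) v) _
  with () ∷ _ ← proj₂ (recompute (isPartition? (zero ∷ xs)) v)

f-A : ∀ n μ → size μ ≡ n → A f μ ≡ suc n * f μ
f-A n μ e = begin
  -- Upper neighbours are never empty, so `f` is `B f` on all of them. At the empty diagram itself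
  -- this fails (`f` is 1 and `B f` is 0), which is why `lower` splits on the size.
  A f μ             ≡⟨ A-cong μ (λ ν e′ → f-B ν e′) ⟩
  A (B f) μ         ≡⟨ A-B f μ ⟩
  f μ + B (A f) μ   ≡⟨ cong (f μ +_) (lower n e) ⟩
  f μ + n * f μ     ∎
  where
  open ≡-Reasoning
  lower : ∀ n → size μ ≡ n → B (A f) μ ≡ n * f μ
  lower zero    e = B-∅ (A f) μ e
  lower (suc n) e = begin
    B (A f) μ                   ≡⟨ B-cong μ (λ κ e′ → f-A n κ (ℕ.suc-injective (trans (sym e′) e))) ⟩
    B (λ κ → suc n * f κ) μ     ≡⟨ B-* (suc n) f μ ⟩
    suc n * B f μ               ≡⟨ cong (suc n *_) (f-B μ e) ⟨
    suc n * f μ                 ∎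

-- Upward walks with a free end

a : ℕ → Partition → ℕ
a zero    = const 1
a (suc k) = A (a k)

-- Applying `A` to the previous instance and moving it past `B` yields one extra copy of
-- `a (suc k)`, which raises the coefficient by one.
a-rec : ∀ k μ → a (suc (suc k)) μ ≡ a (suc k) μ + suc k * a k μ + B (a (suc k)) μ
a-rec zero μ = begin
  A (a 1) μ
    ≡⟨ A-cong μ (λ ν _ → A-1 ν) ⟩
  A (λ ν → 1 + B (a 0) ν) μ
    ≡⟨ A-+ (const 1) (B (a 0)) μ ⟩
  a 1 μ + A (B (a 0)) μ
    ≡⟨ cong (a 1 μ +_) (A-B (a 0) μ) ⟩
  a 1 μ + (1 + B (a 1) μ)
    ≡⟨ ℕ.+-assoc (a 1 μ) 1 _ ⟨
  a 1 μ + 1 + B (a 1) μ ∎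
  where open ≡-Reasoning
a-rec (suc k) μ = begin
  A (a (2 + k)) μ
    ≡⟨ A-cong μ (λ ν _ → a-rec k ν) ⟩
  A (λ ν → a (suc k) ν + suc k * a k ν + B (a (suc k)) ν) μ
    ≡⟨ A-+ (λ ν → a (suc k) ν + suc k * a k ν) (B (a (suc k))) μ ⟩
  A (λ ν → a (suc k) ν + suc k * a k ν) μ + A (B (a (suc k))) μ
    ≡⟨ cong₂ _+_ (trans (A-+ (a (suc k)) (λ ν → suc k * a k ν) μ)
         (cong (a (2 + k) μ +_) (A-* (suc k) (a k) μ))) (A-B (a (suc k)) μ) ⟩
  (a (2 + k) μ + suc k * a (suc k) μ) + (a (suc k) μ + B (a (2 + k)) μ)
    ≡⟨ ℕ.+-assoc (a (2 + k) μ + suc k * a (suc k) μ) (a (suc k) μ) _ ⟨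
  a (2 + k) μ + suc k * a (suc k) μ + a (suc k) μ + B (a (2 + k)) μ
    ≡⟨ cong (_+ B (a (2 + k)) μ) (trans (ℕ.+-assoc (a (2 + k) μ) _ _)
         (cong (a (2 + k) μ +_) (ℕ.+-comm (suc k * a (suc k) μ) _))) ⟩
  a (2 + k) μ + (2 + k) * a (suc k) μ + B (a (2 + k)) μ ∎
  where open ≡-Reasoning

sum-map-0 : ∀ {X : Set} {g : X → ℕ} {xs} → All (λ x → g x ≡ 0) xs → sum (map g xs) ≡ 0
sum-map-0 []       = refl
sum-map-0 (p ∷ ps) = cong₂ _+_ p (sum-map-0 ps)

W0-≢ : ∀ {μ ν} → μ ≢ ν → W 0 μ ν ≡ 0
W0-≢ {μ} {ν} ≢ = trans (W-zero μ ν) (δ-≢ {rows μ} {rows ν} λ { refl → ≢ refl })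

W0-refl : ∀ μ → W 0 μ μ ≡ 1
W0-refl μ = trans (W-zero μ μ) (δ-refl (rows μ))

sum-W0 : ∀ {μ νs} → Unique νs → μ ∈ νs → sum (map (W 0 μ) νs) ≡ 1
sum-W0 {μ} {νs} (x∉ ∷ u) (here refl) = cong₂ _+_ (W0-refl μ) (sum-map-0 (All.map W0-≢ x∉))
sum-W0 {μ} (x∉ ∷ u) (there m) = cong₂ _+_ (W0-≢ (All.lookup x∉ m ∘ sym)) (sum-W0 u m)

sum-A : ∀ (F : Partition → Partition → ℕ) μ νs →
  sum (map (λ ν → A (λ κ → F κ ν) μ) νs) ≡ A (λ κ → sum (map (F κ) νs)) μ
sum-A F μ [] = sym (sum-map-0 {xs = up μ} (All.universal (λ _ → refl) (up μ)))
sum-A F μ (ν ∷ νs) = trans (cong (A (λ κ → F κ ν) μ +_) (sum-A F μ νs))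
  (sym (A-+ (λ κ → F κ ν) (λ κ → sum (map (F κ) νs)) μ))

sum-W : ∀ k {n} μ → k + size μ ≡ n → sum (map (W k μ) (𝕐 n)) ≡ a k μ
sum-W zero    {n} μ e = sum-W0 (𝕐-unique n) (Equivalence.from (∈-𝕐 {μ} {n}) e)
sum-W (suc k) {n} μ e = begin
  sum (map (W (suc k) μ) (𝕐 n))             ≡⟨ cong sum (List.map-cong (W-suc k μ) (𝕐 n)) ⟩
  sum (map (λ ν → A (λ κ → W k κ ν) μ) (𝕐 n)) ≡⟨ sum-A (W k) μ (𝕐 n) ⟩
  A (λ κ → sum (map (W k κ) (𝕐 n))) μ
    ≡⟨ A-cong μ (λ κ e′ → sum-W k κ (trans (cong (k +_) e′) (trans (ℕ.+-suc k _) e))) ⟩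
  A (a k) μ ∎
  where open ≡-Reasoning

d𝕐-a : ∀ k μ → d𝕐 μ (k + size μ) ≡ a k μ
d𝕐-a k μ = trans
  (cong sum (List.map-cong-local (All.tabulate {xs = 𝕐 n} λ {ν} m → cong (λ j → W j μ ν)
    (trans (cong (_∸ size μ) (Equivalence.to (∈-𝕐 {ν} {n}) m)) (ℕ.m+n∸n≡m k (size μ))))))
  (sum-W k μ refl)
  where n = k + size μ

-- Asymptotics of the numbers of upward walks

-- e k j is C(k, j) t (k ∸ j).
e : ℕ → ℕ → ℕ
e zero          zero          = 1
e zero          (suc j)       = 0
e (suc zero)    zero          = 1
e (suc zero)    (suc zero)    = 1
e (suc zero)    (suc (suc j)) = 0
e (suc (suc k)) zero          = e (suc k) zero + suc k * e k zero
e (suc (suc k)) (suc j)       = e (suc k) (suc j) + suc k * e k (suc j) + e (suc k) j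

t : ℕ → ℕ
t k = e k 0

-- This is the absorption identity (j + 1) C(k + 1, j + 1) = (k + 1) C(k, j), multiplied by t (k -
-- j). Since `e` is defined by the recurrence that `S-rec` needs, its binomial nature enters only
-- through this lemma.
e-absorb : ∀ k j → suc j * e (suc k) (suc j) ≡ suc k * e k j
e-absorb zero zero                = refl
e-absorb zero (suc j)             = ℕ.*-zeroʳ (suc (suc j))
e-absorb (suc zero) zero          = refl
e-absorb (suc zero) (suc zero)    = refl
e-absorb (suc zero) (suc (suc j)) = ℕ.*-zeroʳ j
e-absorb (suc (suc k)) zero       = begin
  1 * (e (2 + k) 1 + (2 + k) * e (1 + k) 1 + T)
    ≡⟨ regroup (2 + k) (e (2 + k) 1) (e (1 + k) 1) T ⟩
  1 * e (2 + k) 1 + (2 + k) * (1 * e (1 + k) 1) + T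
    ≡⟨ cong₂ (λ x y → x + (2 + k) * y + T) (e-absorb (suc k) 0) (e-absorb k 0) ⟩
  (2 + k) * t (1 + k) + (2 + k) * ((1 + k) * t k) + T
    ≡⟨ regroup′ (1 + k) (t (1 + k)) ((1 + k) * t k) ⟩
  (3 + k) * T ∎
  where
  open ≡-Reasoning
  T = t (2 + k)
  regroup : ∀ m x y z → 1 * (x + m * y + z) ≡ 1 * x + m * (1 * y) + z
  regroup = solve-∀
  regroup′ : ∀ m x y → suc m * x + suc m * y + (x + y) ≡ suc (suc m) * (x + y)
  regroup′ = solve-∀
e-absorb (suc (suc k)) (suc j) = begin
  (2 + j) * (e (2 + k) (2 + j) + (2 + k) * e (1 + k) (2 + j) + T)
    ≡⟨ regroup (1 + j) (2 + k) (e (2 + k) (2 + j)) (e (1 + k) (2 + j)) T ⟩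
  (2 + j) * e (2 + k) (2 + j) + (2 + k) * ((2 + j) * e (1 + k) (2 + j)) + (1 + j) * T + T
    ≡⟨ cong₂ (λ x y → x + (1 + j) * T + y) (cong₂ (λ x y → x + (2 + k) * y)
         (e-absorb (suc k) (suc j)) (e-absorb k (suc j))) refl ⟩
  (2 + k) * e (1 + k) (1 + j) + (2 + k) * ((1 + k) * e k (1 + j)) + (1 + j) * T + T
    -- Only `1 + j` of the `2 + j` copies of `T` are absorbed here; the remaining one is the last of
    -- the `3 + k` copies in the result.
    ≡⟨ cong (λ x → (2 + k) * e (1 + k) (1 + j) + (2 + k) * ((1 + k) * e k (1 + j)) + x + T)
         (e-absorb (suc k) j) ⟩
  (2 + k) * e (1 + k) (1 + j) + (2 + k) * ((1 + k) * e k (1 + j)) + (2 + k) * e (1 + k) j + T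
    ≡⟨ regroup′ (2 + k) (e (1 + k) (1 + j)) ((1 + k) * e k (1 + j)) (e (1 + k) j) ⟩
  (3 + k) * T ∎
  where
  open ≡-Reasoning
  T = e (2 + k) (1 + j)
  regroup : ∀ i m x y z → suc i * (x + m * y + z) ≡ suc i * x + m * (suc i * y) + i * z + z
  regroup = solve-∀
  regroup′ : ∀ m x y z → m * x + m * y + m * z + (x + y + z) ≡ suc m * (x + y + z)
  regroup′ = solve-∀

S : ℕ → (ℕ → ℕ) → ℕ → ℕ
S zero    p k = 0
S (suc N) p k = S N p k + e k N * p N

S-zero : ∀ N p → S (suc N) p 0 ≡ p 0
S-zero zero    p = ℕ.+-identityʳ (p 0)
S-zero (suc N) p = trans (ℕ.+-identityʳ _) (S-zero N p)

S-one : ∀ N p → S (suc (suc N)) p 1 ≡ p 0 + p 1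
S-one zero    p = cong₂ _+_ (ℕ.+-identityʳ (p 0)) (ℕ.+-identityʳ (p 1))
S-one (suc N) p = trans (ℕ.+-identityʳ _) (S-one N p)

-- The last term in the recurrence for `e` has its second index lowered by one; reindexing moves the
-- shift onto `p` and drops one summand.
S-rec : ∀ N p k → S (suc N) p (2 + k) ≡
  S (suc N) p (1 + k) + suc k * S (suc N) p k + S N (p ∘ suc) (1 + k)
S-rec zero p k = regroup (1 + k) (t (1 + k)) (t k) (p 0)
  where
  regroup : ∀ m x y q → 0 + (x + m * y) * q ≡ 0 + x * q + m * (0 + y * q) + 0
  regroup = solve-∀
S-rec (suc N) p k = trans
  (cong (_+ e (2 + k) (suc N) * p (suc N)) (S-rec N p k))
  (regroup (1 + k) (S (suc N) p (1 + k)) (S (suc N) p k) (S N (p ∘ suc) (1 + k))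
    (e (1 + k) (suc N)) (e k (suc N)) (e (1 + k) N) (p (suc N)))
  where
  regroup : ∀ m a b c x y z q → (a + m * b + c) + (x + m * y + z) * q ≡
    (a + x * q) + m * (b + y * q) + (c + z * q)
  regroup = solve-∀

c : ℕ → Partition → ℕ
c zero    = const 1
c (suc j) = B (c j)

B-S : ∀ N k μ → B (λ κ → S N (λ j → c j κ) k) μ ≡ S N (λ j → c (suc j) μ) k
B-S zero    k μ = B-0 μ
B-S (suc N) k μ = trans (B-+ (λ κ → S N (λ j → c j κ) k) (λ κ → e k N * c N κ) μ)
  (cong₂ _+_ (B-S N k μ) (B-* (e k N) (c N) μ))

a-S : ∀ k {N} μ → size μ ≡ N → a k μ ≡ S (suc N) (λ j → c j μ) k
a-S zero {N} μ |μ| = sym (S-zero N (λ j → c j μ))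
a-S (suc zero) {zero}  μ |μ| = trans (A-1 μ) (cong suc (B-∅ (a 0) μ |μ|))
a-S (suc zero) {suc N} μ |μ| = trans (A-1 μ) (sym (S-one N (λ j → c j μ)))
a-S (suc (suc k)) {N} μ |μ| = begin
  a (2 + k) μ
    ≡⟨ a-rec k μ ⟩
  a (1 + k) μ + suc k * a k μ + B (a (1 + k)) μ
    ≡⟨ cong₂ _+_ (cong₂ (λ x y → x + suc k * y) (a-S (suc k) μ |μ|) (a-S k μ |μ|))
         -- A lower neighbour has one box fewer, so its expansion has `N` terms instead of `suc N`,
         -- as the last sum of `S-rec` requires.
         (trans (B-cong μ λ κ e′ → trans (a-S (suc k) κ refl)
             (cong (λ M → S M (λ j → c j κ) (suc k)) (trans (sym e′) |μ|)))
           (B-S N (suc k) μ)) ⟩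
  S (suc N) cs (1 + k) + suc k * S (suc N) cs k + S N (cs ∘ suc) (1 + k)
    ≡⟨ S-rec N cs k ⟨
  S (suc N) cs (2 + k) ∎
  where
  open ≡-Reasoning
  cs : ℕ → ℕ
  cs j = c j μ

a-∅ : ∀ k → a k ∅ ≡ t k
a-∅ k = trans (a-S k ∅ refl) (ℕ.*-identityʳ (t k))

c-top : ∀ N μ → size μ ≡ N → c N μ ≡ f μ
c-top zero    μ |μ| = sym (f-zero μ |μ|)
c-top (suc N) μ |μ| = trans
  (B-cong μ λ κ e′ → c-top N κ (ℕ.suc-injective (trans (sym e′) |μ|)))
  (sym (f-B μ |μ|))

-- Small x T is x = o(T).
Small : (ℕ → ℕ) → (ℕ → ℕ) → Set
Small x T = ∀ L → ∃ λ K → ∀ k → K ≤ k → L * x k ≤ T k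

Small-mono : ∀ {x x′ T T′} → (∀ k → x k ≤ x′ k) → (∀ k → T k ≤ T′ k) → Small x′ T → Small x T′
Small-mono x≤ T≤ s L with s L
... | K , h = K , λ k K≤k → ℕ.≤-trans (ℕ.*-monoʳ-≤ L (x≤ k)) (ℕ.≤-trans (h k K≤k) (T≤ k))

Small-0 : ∀ {T} → Small (const 0) T
Small-0 L = 0 , λ k _ → ℕ.≤-trans (ℕ.≤-reflexive (ℕ.*-zeroʳ L)) z≤n

Small-* : ∀ m {x T} → Small x T → Small (λ k → m * x k) T
Small-* m {x} {T} s L with s (L * m)
... | K , h = K , λ k K≤k → subst (_≤ T k) (ℕ.*-assoc L m (x k)) (h k K≤k)

Small-+ : ∀ {x y T} → Small x T → Small y T → Small (λ k → x k + y k) T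
Small-+ {x} {y} {T} s s′ L with s (2 * L) | s′ (2 * L)
... | K , h | K′ , h′ = K ⊔ K′ , λ k K≤k → ℕ.*-cancelˡ-≤ 2
  (subst₂ _≤_ (eq L (x k) (y k)) (cong (T k +_) (sym (ℕ.+-identityʳ (T k))))
    (ℕ.+-mono-≤ (h k (ℕ.m⊔n≤o⇒m≤o K K′ K≤k)) (h′ k (ℕ.m⊔n≤o⇒n≤o K K′ K≤k))))
  where
  eq : ∀ L x y → 2 * L * x + 2 * L * y ≡ 2 * (L * (x + y))
  eq = solve-∀

Small-shift : ∀ j {x T} → Small x T → Small (λ k → x (k + j)) (λ k → T (k + j))
Small-shift j s L with s L
... | K , h = K , λ k K≤k → h (k + j) (ℕ.≤-trans K≤k (ℕ.m≤m+n k j))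

Small-unshift : ∀ {x T} → Small (x ∘ suc) (T ∘ suc) → Small x T
Small-unshift s L with s L
... | K , h = suc K , λ { (suc k) (s≤s K≤k) → h k K≤k }

-- Growth of the involution numbers

t-step : ∀ k → t k ≤ t (suc k)
t-step zero    = ℕ.≤-refl
t-step (suc k) = ℕ.m≤m+n _ _

t-mono : ∀ {m n} → m ≤ n → t m ≤ t n
t-mono {m} {n} m≤n = go (ℕ.≤⇒≤′ m≤n)
  where
  go : ∀ {m n} → m ≤′ n → t m ≤ t n
  go ≤′-refl = ℕ.≤-refl
  go {n = suc n} (≤′-step q) = ℕ.≤-trans (go q) (t-step n)

-- The ratio r = t (1 + k) / t k satisfies k ≤ r² − r ≤ k + 1; each bound at k
-- gives the other one at k + 1.
t-upper : ∀ k → t (suc k) * t (suc k) ≤ t k * t (suc k) + suc k * (t k * t k)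
t-lower : ∀ k → t k * t (suc k) + suc k * (t k * t k) ≤ t (suc k) * t (suc k) + t k * t k

-- In terms of the ratio r of consecutive values: r² ≥ r + k ≥ k + 1, by `t-lower` and r ≥ 1.
t-square : ∀ k → suc k * (t k * t k) ≤ t (suc k) * t (suc k)
t-square k = ℕ.+-cancelˡ-≤ (t k * t k) _ _ (ℕ.≤-trans
  (ℕ.+-monoˡ-≤ (suc k * (t k * t k)) (ℕ.*-monoʳ-≤ (t k) (t-step k)))
  (ℕ.≤-trans (t-lower k) (ℕ.≤-reflexive (ℕ.+-comm _ (t k * t k)))))

t-upper zero = s≤s z≤n
t-upper (suc k) = begin
  (v + m * u) * (v + m * u)                                  ≡⟨ lhs m u v ⟩
  (v * v + m * (u * v)) + m * (u * v + m * (u * u))          ≤⟨ ℕ.+-monoʳ-≤ (v * v + m * (u * v)) (ℕ.*-monoʳ-≤ m (t-lower k)) ⟩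
  (v * v + m * (u * v)) + m * (v * v + u * u)                ≡⟨ mid m u v ⟩
  (v * v + m * (u * v)) + (m * (v * v) + m * (u * u))        ≤⟨ ℕ.+-monoʳ-≤ (v * v + m * (u * v)) (ℕ.+-monoʳ-≤ (m * (v * v)) (t-square k)) ⟩
  (v * v + m * (u * v)) + (m * (v * v) + v * v)              ≡⟨ rhs m u v ⟩
  v * (v + m * u) + suc m * (v * v)                          ∎
  where
  open ℕ.≤-Reasoning
  m = suc k
  u = t k
  v = t (suc k)
  lhs : ∀ m u v → (v + m * u) * (v + m * u) ≡ (v * v + m * (u * v)) + m * (u * v + m * (u * u))
  lhs = solve-∀
  mid : ∀ m u v → (v * v + m * (u * v)) + m * (v * v + u * u) ≡ (v * v + m * (u * v)) + (m * (v * v) + m * (u * u))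
  mid = solve-∀
  rhs : ∀ m u v → (v * v + m * (u * v)) + (m * (v * v) + v * v) ≡ v * (v + m * u) + suc m * (v * v)
  rhs = solve-∀
t-lower zero = s≤s (s≤s z≤n)
t-lower (suc k) = begin
  v * (v + m * u) + suc m * (v * v)                       ≡⟨ lhs m u v ⟩
  (v * v + v * v + m * (u * v)) + m * (v * v)             ≤⟨ ℕ.+-monoʳ-≤ (v * v + v * v + m * (u * v)) (ℕ.*-monoʳ-≤ m (t-upper k)) ⟩
  (v * v + v * v + m * (u * v)) + m * (u * v + m * (u * u)) ≡⟨ rhs m u v ⟩
  (v + m * u) * (v + m * u) + v * v                       ∎
  where
  open ℕ.≤-Reasoning
  m = suc k
  u = t k
  v = t (suc k)
  lhs : ∀ m u v → v * (v + m * u) + suc m * (v * v) ≡ (v * v + v * v + m * (u * v)) + m * (v * v)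
  lhs = solve-∀
  rhs : ∀ m u v → (v * v + v * v + m * (u * v)) + m * (u * v + m * (u * u)) ≡ (v + m * u) * (v + m * u) + v * v
  rhs = solve-∀

square-cancel-≤ : ∀ {x y} → x * x ≤ y * y → x ≤ y
square-cancel-≤ {x} {y} p with x ℕ.≤? y
... | yes q = q
... | no ¬q = contradiction (ℕ.*-mono-< (ℕ.≰⇒> ¬q) (ℕ.≰⇒> ¬q)) (ℕ.≤⇒≯ p)

-- By `t-square` the ratio is at least the square root of `suc k`, hence the threshold `L * L`.
t-Small : Small t (t ∘ suc)
t-Small L = L * L , λ k L²≤k → square-cancel-≤ (begin
  L * t k * (L * t k)    ≡⟨ eq L (t k) ⟩
  L * L * (t k * t k)    ≤⟨ ℕ.*-monoˡ-≤ (t k * t k) (ℕ.≤-trans L²≤k (ℕ.n≤1+n k)) ⟩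
  suc k * (t k * t k)    ≤⟨ t-square k ⟩
  t (suc k) * t (suc k)  ∎)
  where
  open ℕ.≤-Reasoning
  eq : ∀ L u → L * u * (L * u) ≡ L * L * (u * u)
  eq = solve-∀

-- t (k + j) ~ j! e k j, with a remainder bounded through
-- t (2 + m) = t (1 + m) + j t m + (1 + k) t m for m = k + j.
t-e : ∀ j → ∃ λ r → Small r (λ k → t (k + j)) × (∀ k → t (k + j) ≡ j ! * e k j + r k)
t-e zero = const 0 , Small-0 , λ k → trans (cong t (ℕ.+-identityʳ k))
  (sym (trans (ℕ.+-identityʳ _) (ℕ.*-identityˡ (e k 0))))
t-e (suc j) with t-e j
... | r , s , eq = r′ , Small-unshift s′ , eq′
  where
  r′ : ℕ → ℕ
  -- `e 0 (suc j)` is 0, so at 0 the remainder is the whole value; `Small-unshift` ignores this one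
  -- term.
  r′ zero    = t (suc j)
  r′ (suc k) = t (suc (k + j)) + j * t (k + j) + suc k * r k

  T : ℕ → ℕ
  T k = t (suc (k + suc j))

  T-eq : ∀ k → T k ≡ t (2 + (k + j))
  T-eq k = cong (t ∘ suc) (ℕ.+-suc k j)

  s′ : Small (r′ ∘ suc) T
  s′ = Small-+ {λ k → t (suc (k + j)) + j * t (k + j)} {λ k → suc k * r k}
    (Small-+ {λ k → t (suc (k + j))} {λ k → j * t (k + j)}
      (Small-mono (λ k → ℕ.≤-reflexive (cong t (sym (ℕ.+-suc k j)))) (λ k → ℕ.≤-refl) (Small-shift (suc j) t-Small))
      (Small-* j (Small-mono (λ k → t-mono (ℕ.+-monoʳ-≤ k (ℕ.n≤1+n j))) (λ k → ℕ.≤-refl) (Small-shift (suc j) t-Small))))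
    -- The factor `suc k` grows with `k`, so `Small-*` cannot absorb it. It is paid for by the
    -- summand `suc (k + j) * t (k + j)` of `t (2 + (k + j))`.
    λ L → proj₁ (s L) , λ k K≤k → begin
      L * (suc k * r k)        ≡⟨ swap L (suc k) (r k) ⟩
      suc k * (L * r k)        ≤⟨ ℕ.*-monoʳ-≤ (suc k) (proj₂ (s L) k K≤k) ⟩
      suc k * t (k + j)        ≤⟨ ℕ.*-monoˡ-≤ (t (k + j)) (s≤s (ℕ.m≤m+n k j)) ⟩
      suc (k + j) * t (k + j)  ≤⟨ ℕ.m≤n+m _ (t (suc (k + j))) ⟩
      t (2 + (k + j))          ≡⟨ T-eq k ⟨
      T k                      ∎
    where
    open ℕ.≤-Reasoning
    swap : ∀ x y z → x * (y * z) ≡ y * (x * z)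
    swap = solve-∀

  eq′ : ∀ k → t (k + suc j) ≡ (suc j) ! * e k (suc j) + r′ k
  eq′ zero    = cong (_+ t (suc j)) (sym (ℕ.*-zeroʳ (suc j !)))
  eq′ (suc k) = begin
    T k
      ≡⟨ T-eq k ⟩
    t (1 + m) + (1 + m) * t m
      ≡⟨ split (t (1 + m)) k j (t m) ⟩
    t (1 + m) + j * t m + suc k * t m
      ≡⟨ cong (λ x → t (1 + m) + j * t m + suc k * x) (eq k) ⟩
    t (1 + m) + j * t m + suc k * (j ! * e k j + r k)
      ≡⟨ regroup (t (1 + m) + j * t m) (suc k) (j !) (e k j) (r k) ⟩
    j ! * (suc k * e k j) + r′ (suc k)
      ≡⟨ cong (λ x → j ! * x + r′ (suc k)) (e-absorb k j) ⟨
    j ! * (suc j * e (suc k) (suc j)) + r′ (suc k)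
      ≡⟨ cong (_+ r′ (suc k)) (assoc (j !) (suc j) (e (suc k) (suc j))) ⟩
    (suc j) ! * e (suc k) (suc j) + r′ (suc k) ∎
    where
    open ≡-Reasoning
    m = k + j
    split : ∀ x k j y → x + suc (k + j) * y ≡ x + j * y + suc k * y
    split = solve-∀
    regroup : ∀ x n p y z → x + n * (p * y + z) ≡ p * (n * y) + (x + n * z)
    regroup = solve-∀
    assoc : ∀ x y z → x * (y * z) ≡ y * x * z
    assoc = solve-∀

e≤t : ∀ j k → e k j ≤ t (k + j)
e≤t j k with t-e j
... | r , _ , eq = begin
  e k j             ≤⟨ ℕ.m≤n*m (e k j) (j !) ⦃ ℕ._!≢0 j ⦄ ⟩
  j ! * e k j       ≤⟨ ℕ.m≤m+n _ (r k) ⟩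
  j ! * e k j + r k ≡⟨ eq k ⟨
  t (k + j)         ∎
  where open ℕ.≤-Reasoning

e-Small : ∀ {j N} → j < N → Small (λ k → e k j) (λ k → t (k + N))
e-Small {j} {suc N} (s≤s j≤N) = Small-mono
  (λ k → ℕ.≤-trans (e≤t j k) (t-mono (ℕ.+-monoʳ-≤ k j≤N)))
  (λ k → ℕ.≤-reflexive (cong t (sym (ℕ.+-suc k N))))
  (Small-shift N t-Small)

S-Small : ∀ {M N} p → M ≤ N → Small (S M p) (λ k → t (k + N))
S-Small {zero}  p M≤N = Small-0
S-Small {suc M} p M<N = Small-+ {S M p} (S-Small p (ℕ.<⇒≤ M<N))
  (Small-mono (λ k → ℕ.≤-reflexive (ℕ.*-comm (e k M) (p M))) (λ _ → ℕ.≤-refl)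
    (Small-* (p M) (e-Small M<N)))

-- The remainder `x` comes from `t-e` applied to the top term of the expansion, and `y` collects the
-- terms of index below `size μ`. Keeping them on opposite sides avoids subtraction.
a-asymptotic : ∀ μ → ∃₂ λ x y → Small x (λ k → t (k + size μ)) × Small y (λ k → t (k + size μ)) ×
  (∀ k → size μ ! * a k μ + x k ≡ f μ * t (k + size μ) + y k)
a-asymptotic μ with t-e (size μ)
... | r , s , eq =
  (λ k → f μ * r k) , (λ k → N ! * S N cs k) ,
  Small-* (f μ) s , Small-* (N !) (S-Small cs ℕ.≤-refl) , λ k → begin
    N ! * a k μ + f μ * r k
      ≡⟨ cong (λ x → N ! * x + f μ * r k) (a-S k μ refl) ⟩
    N ! * (S N cs k + e k N * cs N) + f μ * r k
      ≡⟨ cong (λ x → N ! * (S N cs k + e k N * x) + f μ * r k) (c-top N μ refl) ⟩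
    N ! * (S N cs k + e k N * f μ) + f μ * r k
      ≡⟨ regroup (N !) (S N cs k) (e k N) (f μ) (r k) ⟩
    f μ * (N ! * e k N + r k) + N ! * S N cs k
      ≡⟨ cong (λ x → f μ * x + N ! * S N cs k) (eq k) ⟨
    f μ * t (k + N) + N ! * S N cs k ∎
  where
  open ≡-Reasoning
  N = size μ
  cs : ℕ → ℕ
  cs j = c j μ
  regroup : ∀ n s e f r → n * (s + e * f) + f * r ≡ f * (n * e + r) + n * s
  regroup = solve-∀

-- Fractions and limits of rational sequences

infix 7 _⁄_

_⁄_ : ∀ m n .⦃ _ : ℕ.NonZero n ⦄ → ℚ
m ⁄ n = pos m ℚ./ n

-- `_⁄_` cancels a gcd that is stuck on open terms. Arithmetic of fractions therefore passes to
-- unnormalised rationals, where equality and order are cross multiplication.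
toℚᵘ-⁄ : ∀ m n → ℚ.toℚᵘ (m ⁄ suc n) ℚᵘ.≃ ℚᵘ.mkℚᵘ (pos m) n
toℚᵘ-⁄ m n = ℚ.toℚᵘ-fromℚᵘ (ℚᵘ.mkℚᵘ (pos m) n)

⁄-≡ : ∀ m n o q .⦃ _ : ℕ.NonZero n ⦄ .⦃ _ : ℕ.NonZero q ⦄ → m * q ≡ o * n → m ⁄ n ≡ o ⁄ q
⁄-≡ m (suc n) o (suc q) eq = ℚ.fromℚᵘ-cong {ℚᵘ.mkℚᵘ (pos m) n} {ℚᵘ.mkℚᵘ (pos o) q}
  (ℚᵘ.*≡* (trans (sym (ℤ.pos-* m (suc q))) (trans (cong pos eq) (ℤ.pos-* o (suc n)))))

⁄-≤ : ∀ m n o q .⦃ _ : ℕ.NonZero n ⦄ .⦃ _ : ℕ.NonZero q ⦄ → m * q ≤ o * n → m ⁄ n ℚ.≤ o ⁄ q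
⁄-≤ m (suc n) o (suc q) le = ℚ.toℚᵘ-cancel-≤ (begin
  ℚ.toℚᵘ (m ⁄ suc n)   ≃⟨ toℚᵘ-⁄ m n ⟩
  ℚᵘ.mkℚᵘ (pos m) n      ≤⟨ ℚᵘ.*≤* (subst₂ ℤ._≤_ (ℤ.pos-* m (suc q)) (ℤ.pos-* o (suc n)) (ℤ.+≤+ le)) ⟩
  ℚᵘ.mkℚᵘ (pos o) q      ≃⟨ toℚᵘ-⁄ o q ⟨
  ℚ.toℚᵘ (o ⁄ suc q)   ∎)
  where open ℚᵘ.≤-Reasoning

⁄-* : ∀ m n o q .⦃ _ : ℕ.NonZero n ⦄ .⦃ _ : ℕ.NonZero q ⦄ .⦃ _ : ℕ.NonZero (n * q) ⦄ →
  (m ⁄ n) ℚ.* (o ⁄ q) ≡ (m * o) ⁄ (n * q)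
⁄-* m (suc n) o (suc q) = ℚ.toℚᵘ-injective (begin-equality
  ℚ.toℚᵘ ((m ⁄ suc n) ℚ.* (o ⁄ suc q))             ≃⟨ ℚ.toℚᵘ-homo-* (m ⁄ suc n) (o ⁄ suc q) ⟩
  ℚ.toℚᵘ (m ⁄ suc n) ℚᵘ.* ℚ.toℚᵘ (o ⁄ suc q)       ≃⟨ ℚᵘ.*-cong (toℚᵘ-⁄ m n) (toℚᵘ-⁄ o q) ⟩
  ℚᵘ.mkℚᵘ (pos m) n ℚᵘ.* ℚᵘ.mkℚᵘ (pos o) q             ≃⟨ ℚᵘ.*≡* (cong (ℤ._* pos (suc n * suc q)) (sym (ℤ.pos-* m o))) ⟩
  ℚᵘ.mkℚᵘ (pos (m * o)) (q + n * suc q)              ≃⟨ toℚᵘ-⁄ (m * o) (q + n * suc q) ⟨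
  ℚ.toℚᵘ ((m * o) ⁄ (suc n * suc q))               ∎)
  where open ℚᵘ.≤-Reasoning

⁄-+ : ∀ m n o q .⦃ _ : ℕ.NonZero n ⦄ .⦃ _ : ℕ.NonZero q ⦄ .⦃ _ : ℕ.NonZero (n * q) ⦄ →
  (m ⁄ n) ℚ.+ (o ⁄ q) ≡ (m * q + o * n) ⁄ (n * q)
⁄-+ m (suc n) o (suc q) = ℚ.toℚᵘ-injective (begin-equality
  ℚ.toℚᵘ ((m ⁄ suc n) ℚ.+ (o ⁄ suc q))             ≃⟨ ℚ.toℚᵘ-homo-+ (m ⁄ suc n) (o ⁄ suc q) ⟩
  ℚ.toℚᵘ (m ⁄ suc n) ℚᵘ.+ ℚ.toℚᵘ (o ⁄ suc q)       ≃⟨ ℚᵘ.+-cong (toℚᵘ-⁄ m n) (toℚᵘ-⁄ o q) ⟩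
  ℚᵘ.mkℚᵘ (pos m) n ℚᵘ.+ ℚᵘ.mkℚᵘ (pos o) q             ≃⟨ ℚᵘ.*≡* (cong (ℤ._* pos (suc n * suc q))
      (sym (trans (ℤ.pos-+ (m * suc q) (o * suc n)) (cong₂ ℤ._+_ (ℤ.pos-* m (suc q)) (ℤ.pos-* o (suc n)))))) ⟩
  ℚᵘ.mkℚᵘ (pos (m * suc q + o * suc n)) (q + n * suc q) ≃⟨ toℚᵘ-⁄ (m * suc q + o * suc n) (q + n * suc q) ⟨
  ℚ.toℚᵘ ((m * suc q + o * suc n) ⁄ (suc n * suc q))  ∎)
  where open ℚᵘ.≤-Reasoning

⁄-pos : ∀ m n .⦃ _ : ℕ.NonZero m ⦄ .⦃ _ : ℕ.NonZero n ⦄ → 0ℚ ℚ.< m ⁄ n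
⁄-pos m n = ℚ.positive⁻¹ (m ⁄ n) ⦃ ℚ.normalize-pos m n ⦄

⁄-self : ∀ n .⦃ _ : ℕ.NonZero n ⦄ → n ⁄ n ≡ 1ℚ
⁄-self n = ⁄-≡ n n 1 1 (trans (ℕ.*-identityʳ n) (sym (ℕ.*-identityˡ n)))

recip-⁄ : ∀ m n .⦃ _ : ℕ.NonZero m ⦄ .⦃ _ : ℕ.NonZero n ⦄ → recip (m ⁄ n) ≡ n ⁄ m
recip-⁄ m n = begin
  recip (m ⁄ n)                           ≡⟨ ℚ.*-identityʳ _ ⟨
  recip (m ⁄ n) ℚ.* 1ℚ                    ≡⟨ cong (recip (m ⁄ n) ℚ.*_) cancel ⟨
  recip (m ⁄ n) ℚ.* ((m ⁄ n) ℚ.* (n ⁄ m)) ≡⟨ ℚ.*-assoc (recip (m ⁄ n)) _ _ ⟨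
  recip (m ⁄ n) ℚ.* (m ⁄ n) ℚ.* (n ⁄ m)   ≡⟨ cong (ℚ._* (n ⁄ m)) (recip-inverse (m ⁄ n) (⁄-pos m n)) ⟩
  1ℚ ℚ.* (n ⁄ m)                          ≡⟨ ℚ.*-identityˡ _ ⟩
  n ⁄ m                                   ∎
  where
  open ≡-Reasoning
  instance
    nm≢0 = ℕ.m*n≢0 n m
    mn≢0 = ℕ.m*n≢0 m n
  cancel : (m ⁄ n) ℚ.* (n ⁄ m) ≡ 1ℚ
  cancel = trans (⁄-* m n n m)
    (trans (⁄-≡ (m * n) (n * m) (m * n) (m * n) (cong (m * n *_) (ℕ.*-comm m n))) (⁄-self (m * n)))

∑ℚ : List ℚ → ℚ
∑ℚ = foldr ℚ._+_ 0ℚ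

∑-⁄ : ∀ {X : Set} (g : X → ℕ) D .⦃ _ : ℕ.NonZero D ⦄ xs →
  ∑ℚ (map (λ x → g x ⁄ D) xs) ≡ sum (map g xs) ⁄ D
∑-⁄ g D []       = ⁄-≡ 0 1 0 D refl
∑-⁄ g D (x ∷ xs) = begin
  g x ⁄ D ℚ.+ ∑ℚ (map (λ x → g x ⁄ D) xs)  ≡⟨ cong (g x ⁄ D ℚ.+_) (∑-⁄ g D xs) ⟩
  g x ⁄ D ℚ.+ s ⁄ D                        ≡⟨ ⁄-+ (g x) D s D ⟩
  (g x * D + s * D) ⁄ (D * D)              ≡⟨ ⁄-≡ (g x * D + s * D) (D * D) (g x + s) D (eq (g x) s D) ⟩
  (g x + s) ⁄ D                            ∎
  where
  open ≡-Reasoning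
  s = sum (map g xs)
  instance DD≢0 = ℕ.m*n≢0 D D
  eq : ∀ y s D → (y * D + s * D) * D ≡ (y + s) * (D * D)
  eq = solve-∀

∑-*ʳ : ∀ {X : Set} (g : X → ℚ) r xs → ∑ℚ (map (λ x → g x ℚ.* r) xs) ≡ ∑ℚ (map g xs) ℚ.* r
∑-*ʳ g r []       = sym (ℚ.*-zeroˡ r)
∑-*ʳ g r (x ∷ xs) = trans (cong (g x ℚ.* r ℚ.+_) (∑-*ʳ g r xs)) (sym (ℚ.*-distribʳ-+ r (g x) _))

-- The fractions differ by (y - x) / (N T), hence by at most 1 / (L N), which is weakened to 1 / L.
⁄-close : ∀ {a T c N x y} L .⦃ _ : ℕ.NonZero T ⦄ .⦃ _ : ℕ.NonZero N ⦄ .⦃ _ : ℕ.NonZero L ⦄ →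
  N * a + x ≡ c * T + y → L * x ≤ T → L * y ≤ T →
  (a ⁄ T ℚ.≤ c ⁄ N ℚ.+ 1 ⁄ L) × (c ⁄ N ℚ.≤ a ⁄ T ℚ.+ 1 ⁄ L)
⁄-close {a} {T} {c} {N} {x} {y} L eq Lx≤T Ly≤T =
  subst (a ⁄ T ℚ.≤_) (sym (⁄-+ c N 1 L)) (⁄-≤ a T (c * L + 1 * N) (N * L) (begin
    a * (N * L)             ≡⟨ rotate a N L ⟩
    L * (N * a)             ≤⟨ ℕ.*-monoʳ-≤ L (ℕ.m≤m+n (N * a) x) ⟩
    L * (N * a + x)         ≡⟨ cong (L *_) eq ⟩
    L * (c * T + y)         ≡⟨ ℕ.*-distribˡ-+ L (c * T) y ⟩
    L * (c * T) + L * y     ≤⟨ ℕ.+-monoʳ-≤ (L * (c * T)) (ℕ.≤-trans Ly≤T (ℕ.m≤n*m T N)) ⟩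
    L * (c * T) + N * T     ≡⟨ factor L c N T ⟩
    (c * L + 1 * N) * T     ∎)) ,
  subst (c ⁄ N ℚ.≤_) (sym (⁄-+ a T 1 L)) (⁄-≤ c N (a * L + 1 * T) (T * L) (begin
    c * (T * L)             ≡⟨ rotate′ c T L ⟩
    L * (c * T)             ≤⟨ ℕ.*-monoʳ-≤ L (ℕ.m≤m+n (c * T) y) ⟩
    L * (c * T + y)         ≡⟨ cong (L *_) (sym eq) ⟩
    L * (N * a + x)         ≡⟨ ℕ.*-distribˡ-+ L (N * a) x ⟩
    L * (N * a) + L * x     ≤⟨ ℕ.+-monoʳ-≤ (L * (N * a)) (ℕ.≤-trans Lx≤T (ℕ.m≤n*m T N)) ⟩
    L * (N * a) + N * T     ≡⟨ factor′ L a N T ⟩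
    (a * L + 1 * T) * N     ∎))
  where
  open ℕ.≤-Reasoning
  instance
    NL≢0 = ℕ.m*n≢0 N L
    TL≢0 = ℕ.m*n≢0 T L
  rotate : ∀ a N L → a * (N * L) ≡ L * (N * a)
  rotate = solve-∀
  rotate′ : ∀ c T L → c * (T * L) ≡ L * (c * T)
  rotate′ = solve-∀
  factor : ∀ L c N T → L * (c * T) + N * T ≡ (c * L + 1 * N) * T
  factor = solve-∀
  factor′ : ∀ L a N T → L * (N * a) + N * T ≡ (a * L + 1 * T) * N
  factor′ = solve-∀

archimedean : ∀ {ε} → 0ℚ ℚ.< ε → ∃ λ n → 1 ⁄ suc n ℚ.≤ ε
archimedean {mkℚ (pos 0) d _} (ℚ.*<* (ℤ.+<+ ()))
archimedean {ε@(mkℚ +[1+ n ] d _)} _ = d , subst (1 ⁄ suc d ℚ.≤_) (ℚ.↥p/↧p≡p ε)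
  (⁄-≤ 1 (suc d) (suc n) (suc d) (ℕ.*-monoˡ-≤ (suc d) (s≤s (z≤n {n}))))
archimedean {mkℚ ℤ.-[1+ _ ] d _} (ℚ.*<* ())

halve : ∀ {ε} → 0ℚ ℚ.< ε → 0ℚ ℚ.< ½ ℚ.* ε
halve {ε} 0<ε = subst (ℚ._< ½ ℚ.* ε) (ℚ.*-zeroʳ ½) (ℚ.*-monoʳ-<-pos ½ 0<ε)

½+½ : ∀ ε → ½ ℚ.* ε ℚ.+ ½ ℚ.* ε ≡ ε
½+½ = solveℚ 1 (λ ε → con ½ :* ε :+ con ½ :* ε := ε) refl

½ε<ε : ∀ {ε} → 0ℚ ℚ.< ε → ½ ℚ.* ε ℚ.< ε
½ε<ε {ε} 0<ε = subst₂ ℚ._<_ (ℚ.+-identityʳ (½ ℚ.* ε)) (½+½ ε) (ℚ.+-monoʳ-< (½ ℚ.* ε) (halve 0<ε))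

*-positive : ∀ {p q} → 0ℚ ℚ.< p → 0ℚ ℚ.< q → 0ℚ ℚ.< p ℚ.* q
*-positive {p} {q} 0<p 0<q =
  subst (ℚ._< p ℚ.* q) (ℚ.*-zeroʳ p) (ℚ.*-monoʳ-<-pos p ⦃ ℚ.positive 0<p ⦄ 0<q)

recip-positive : ∀ {q} → 0ℚ ℚ.< q → 0ℚ ℚ.< recip q
recip-positive {q} 0<q = ℚ.*-cancelʳ-<-nonNeg q ⦃ ℚ.nonNegative (ℚ.<⇒≤ 0<q) ⦄
  (subst₂ ℚ._<_ (sym (ℚ.*-zeroˡ q)) (sym (recip-inverse q 0<q)) (ℚ.positive⁻¹ 1ℚ))

∣-∣-sym : ∀ p q → ℚ.∣ p ℚ.- q ∣ ≡ ℚ.∣ q ℚ.- p ∣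
∣-∣-sym p q = trans (sym (ℚ.∣-p∣≡∣p∣ (p ℚ.- q)))
  (cong ℚ.∣_∣ (solveℚ 2 (λ p q → :- (p :- q) := q :- p) refl p q))

∣-∣-triangle : ∀ p q r → ℚ.∣ p ℚ.- r ∣ ℚ.≤ ℚ.∣ p ℚ.- q ∣ ℚ.+ ℚ.∣ q ℚ.- r ∣
∣-∣-triangle p q r = subst (λ x → ℚ.∣ x ∣ ℚ.≤ ℚ.∣ p ℚ.- q ∣ ℚ.+ ℚ.∣ q ℚ.- r ∣)
  (solveℚ 3 (λ p q r → (p :- q) :+ (q :- r) := p :- r) refl p q r)
  (ℚ.∣p+q∣≤∣p∣+∣q∣ (p ℚ.- q) (q ℚ.- r))

p<q+r⇒p-q<r : ∀ {p q r} → p ℚ.< q ℚ.+ r → p ℚ.- q ℚ.< r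
p<q+r⇒p-q<r {p} {q} {r} lt = subst (p ℚ.- q ℚ.<_)
  (solveℚ 2 (λ q r → (q :+ r) :- q := r) refl q r) (ℚ.+-monoˡ-< (ℚ.- q) lt)

∣-∣-< : ∀ {p q ε} → p ℚ.< q ℚ.+ ε → q ℚ.< p ℚ.+ ε → ℚ.∣ p ℚ.- q ∣ ℚ.< ε
∣-∣-< {p} {q} {ε} p<q+ε q<p+ε with ℚ.∣p∣≡p∨∣p∣≡-p (p ℚ.- q)
... | inj₁ eq = subst (ℚ._< ε) (sym eq) (p<q+r⇒p-q<r p<q+ε)
... | inj₂ eq = subst (ℚ._< ε)
  (sym (trans eq (solveℚ 2 (λ p q → :- (p :- q) := q :- p) refl p q))) (p<q+r⇒p-q<r q<p+ε)

p≤∣p∣ : ∀ p → p ℚ.≤ ℚ.∣ p ∣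
p≤∣p∣ p with ℚ.∣p∣≡p∨∣p∣≡-p p | ℚ.≤-total 0ℚ p
... | _ | inj₁ 0≤p = ℚ.≤-reflexive (sym (ℚ.0≤p⇒∣p∣≡p 0≤p))
... | _ | inj₂ p≤0 = ℚ.≤-trans p≤0 (ℚ.0≤∣p∣ p)

∣-∣-<⇒< : ∀ {p q ε} → ℚ.∣ p ℚ.- q ∣ ℚ.< ε → p ℚ.< q ℚ.+ ε
∣-∣-<⇒< {p} {q} {ε} lt = subst (ℚ._< q ℚ.+ ε)
  (solveℚ 2 (λ p q → q :+ (p :- q) := p) refl p q)
  (ℚ.+-monoʳ-< q (ℚ.≤-<-trans (p≤∣p∣ (p ℚ.- q)) lt))

-- Convergence to rational limits

infix 4 _⟼_

-- Every real number to be compared has a rational value, so `≈` and positivity reduce to equations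
-- and inequalities in ℚ. Being a record, it lets `s` and `q` be inferred from a proof.
record _⟼_ (s : ℕ → ℚ) (q : ℚ) : Set where
  constructor converges
  field
    close : ∀ ε → 0ℚ ℚ.< ε → ∃ λ N → ∀ n → N ≤ n → ℚ.∣ s n ℚ.- q ∣ ℚ.< ε

open _⟼_

⟼-const : ∀ q → const q ⟼ q
⟼-const q = converges λ ε 0<ε → 0 , λ _ _ → subst (ℚ._< ε) (sym (cong ℚ.∣_∣ (ℚ.+-inverseʳ q))) 0<ε

join-≈ : ∀ {x y q} → seq x ⟼ q → seq y ⟼ q → x ≈ y
join-≈ {x} {y} {q} hx hy ε 0<ε =
  let (M , hx) = close hx (½ ℚ.* ε) (halve 0<ε)
      (N , hy) = close hy (½ ℚ.* ε) (halve 0<ε)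
  in M ⊔ N , λ n ≤n → begin-strict
  ℚ.∣ seq x n ℚ.- seq y n ∣
    ≤⟨ ∣-∣-triangle (seq x n) q (seq y n) ⟩
  ℚ.∣ seq x n ℚ.- q ∣ ℚ.+ ℚ.∣ q ℚ.- seq y n ∣
    <⟨ ℚ.+-mono-< (hx n (ℕ.m⊔n≤o⇒m≤o M N ≤n))
         (subst (ℚ._< ½ ℚ.* ε) (∣-∣-sym (seq y n) q) (hy n (ℕ.m⊔n≤o⇒n≤o M N ≤n))) ⟩
  ½ ℚ.* ε ℚ.+ ½ ℚ.* ε
    ≡⟨ ½+½ ε ⟩
  ε ∎
  where open ℚ.≤-Reasoning

≈-⟼ : ∀ {x y q} → x ≈ y → seq y ⟼ q → seq x ⟼ q
≈-⟼ {x} {y} {q} x≈y hy = converges λ ε 0<ε →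
  let (M , hx) = x≈y (½ ℚ.* ε) (halve 0<ε)
      (N , hy) = close hy (½ ℚ.* ε) (halve 0<ε)
  in M ⊔ N , λ n ≤n → begin-strict
  ℚ.∣ seq x n ℚ.- q ∣
    ≤⟨ ∣-∣-triangle (seq x n) (seq y n) q ⟩
  ℚ.∣ seq x n ℚ.- seq y n ∣ ℚ.+ ℚ.∣ seq y n ℚ.- q ∣
    <⟨ ℚ.+-mono-< (hx n (ℕ.m⊔n≤o⇒m≤o M N ≤n)) (hy n (ℕ.m⊔n≤o⇒n≤o M N ≤n)) ⟩
  ½ ℚ.* ε ℚ.+ ½ ℚ.* ε
    ≡⟨ ½+½ ε ⟩
  ε ∎
  where open ℚ.≤-Reasoning

⟼-+ : ∀ {s u a b} → s ⟼ a → u ⟼ b → (λ n → s n ℚ.+ u n) ⟼ a ℚ.+ b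
⟼-+ {s} {u} {a} {b} hs hu = converges λ ε 0<ε →
  let (M , hs) = close hs (½ ℚ.* ε) (halve 0<ε)
      (N , hu) = close hu (½ ℚ.* ε) (halve 0<ε)
  in M ⊔ N , λ n ≤n → begin-strict
  ℚ.∣ (s n ℚ.+ u n) ℚ.- (a ℚ.+ b) ∣
    ≡⟨ cong ℚ.∣_∣ (solveℚ 4 (λ x y a b → (x :+ y) :- (a :+ b) := (x :- a) :+ (y :- b)) refl (s n) (u n) a b) ⟩
  ℚ.∣ (s n ℚ.- a) ℚ.+ (u n ℚ.- b) ∣
    ≤⟨ ℚ.∣p+q∣≤∣p∣+∣q∣ (s n ℚ.- a) (u n ℚ.- b) ⟩
  ℚ.∣ s n ℚ.- a ∣ ℚ.+ ℚ.∣ u n ℚ.- b ∣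
    <⟨ ℚ.+-mono-< (hs n (ℕ.m⊔n≤o⇒m≤o M N ≤n)) (hu n (ℕ.m⊔n≤o⇒n≤o M N ≤n)) ⟩
  ½ ℚ.* ε ℚ.+ ½ ℚ.* ε
    ≡⟨ ½+½ ε ⟩
  ε ∎
  where open ℚ.≤-Reasoning

⟼-* : ∀ {s u a b} → s ⟼ a → u ⟼ b → (λ n → s n ℚ.* u n) ⟼ a ℚ.* b
⟼-* {s} {u} {a} {b} hs hu = converges λ ε 0<ε →
  let open Estimate ε 0<ε
      (K , h1) = close hs 1ℚ (ℚ.positive⁻¹ 1ℚ)
      (M , h)  = close hs η 0<η
      (N , h′) = close hu η 0<η
  in K ⊔ (M ⊔ N) , λ n ≤n →
    let ≤n′ = ℕ.m⊔n≤o⇒n≤o K (M ⊔ N) ≤n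
    in bound (s n) (u n) (ℚ.<⇒≤ (h1 n (ℕ.m⊔n≤o⇒m≤o K (M ⊔ N) ≤n)))
         (ℚ.<⇒≤ (h n (ℕ.m⊔n≤o⇒m≤o M N ≤n′))) (ℚ.<⇒≤ (h′ n (ℕ.m⊔n≤o⇒n≤o M N ≤n′)))
  where
  module Estimate (ε : ℚ) (0<ε : 0ℚ ℚ.< ε) where
    open ℚ.≤-Reasoning
    -- `β` bounds ∣x∣ + ∣b∣ as soon as `x` is within 1 of `a`; halving `ε` in `η` makes the final
    -- inequality strict.
    β = (ℚ.∣ a ∣ ℚ.+ 1ℚ) ℚ.+ ℚ.∣ b ∣
    0<β : 0ℚ ℚ.< β
    0<β = ℚ.+-mono-<-≤ (ℚ.+-mono-≤-< (ℚ.0≤∣p∣ a) (ℚ.positive⁻¹ 1ℚ)) (ℚ.0≤∣p∣ b)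
    η = recip β ℚ.* (½ ℚ.* ε)
    0<η = *-positive (recip-positive 0<β) (halve 0<ε)
    0≤η = ℚ.<⇒≤ 0<η

    ∣*∣≤ : ∀ p q P → ℚ.∣ p ∣ ℚ.≤ P → ℚ.∣ q ∣ ℚ.≤ η → ℚ.∣ p ℚ.* q ∣ ℚ.≤ P ℚ.* η
    ∣*∣≤ p q P p≤ q≤ = begin
      ℚ.∣ p ℚ.* q ∣          ≡⟨ ℚ.∣p*q∣≡∣p∣*∣q∣ p q ⟩
      ℚ.∣ p ∣ ℚ.* ℚ.∣ q ∣    ≤⟨ ℚ.*-monoˡ-≤-nonNeg ℚ.∣ p ∣ ⦃ ℚ.nonNegative (ℚ.0≤∣p∣ p) ⦄ q≤ ⟩
      ℚ.∣ p ∣ ℚ.* η          ≤⟨ ℚ.*-monoʳ-≤-nonNeg η ⦃ ℚ.nonNegative 0≤η ⦄ p≤ ⟩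
      P ℚ.* η                ∎

    bound : ∀ x y → ℚ.∣ x ℚ.- a ∣ ℚ.≤ 1ℚ → ℚ.∣ x ℚ.- a ∣ ℚ.≤ η → ℚ.∣ y ℚ.- b ∣ ℚ.≤ η →
      ℚ.∣ x ℚ.* y ℚ.- a ℚ.* b ∣ ℚ.< ε
    bound x y x-a≤1 x-a≤η y-b≤η = begin-strict
      ℚ.∣ x ℚ.* y ℚ.- a ℚ.* b ∣
        ≡⟨ cong ℚ.∣_∣ (solveℚ 4 (λ x y a b → x :* y :- a :* b := x :* (y :- b) :+ b :* (x :- a)) refl x y a b) ⟩
      ℚ.∣ x ℚ.* (y ℚ.- b) ℚ.+ b ℚ.* (x ℚ.- a) ∣
        ≤⟨ ℚ.∣p+q∣≤∣p∣+∣q∣ (x ℚ.* (y ℚ.- b)) (b ℚ.* (x ℚ.- a)) ⟩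
      ℚ.∣ x ℚ.* (y ℚ.- b) ∣ ℚ.+ ℚ.∣ b ℚ.* (x ℚ.- a) ∣
        ≤⟨ ℚ.+-mono-≤ (∣*∣≤ x (y ℚ.- b) (ℚ.∣ a ∣ ℚ.+ 1ℚ) ∣x∣≤ y-b≤η)
                      (∣*∣≤ b (x ℚ.- a) ℚ.∣ b ∣ ℚ.≤-refl x-a≤η) ⟩
      (ℚ.∣ a ∣ ℚ.+ 1ℚ) ℚ.* η ℚ.+ ℚ.∣ b ∣ ℚ.* η
        ≡⟨ ℚ.*-distribʳ-+ η (ℚ.∣ a ∣ ℚ.+ 1ℚ) ℚ.∣ b ∣ ⟨
      β ℚ.* (recip β ℚ.* (½ ℚ.* ε))
        ≡⟨ ℚ.*-assoc β (recip β) _ ⟨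
      β ℚ.* recip β ℚ.* (½ ℚ.* ε)
        ≡⟨ cong (ℚ._* (½ ℚ.* ε)) (trans (ℚ.*-comm β (recip β)) (recip-inverse β 0<β)) ⟩
      1ℚ ℚ.* (½ ℚ.* ε)
        ≡⟨ ℚ.*-identityˡ _ ⟩
      ½ ℚ.* ε
        <⟨ ½ε<ε 0<ε ⟩
      ε ∎
      where
      ∣x∣≤ : ℚ.∣ x ∣ ℚ.≤ ℚ.∣ a ∣ ℚ.+ 1ℚ
      ∣x∣≤ = begin
        ℚ.∣ x ∣                        ≡⟨ cong ℚ.∣_∣ (solveℚ 2 (λ x a → x := a :+ (x :- a)) refl x a) ⟩
        ℚ.∣ a ℚ.+ (x ℚ.- a) ∣          ≤⟨ ℚ.∣p+q∣≤∣p∣+∣q∣ a (x ℚ.- a) ⟩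
        ℚ.∣ a ∣ ℚ.+ ℚ.∣ x ℚ.- a ∣      ≤⟨ ℚ.+-monoʳ-≤ ℚ.∣ a ∣ x-a≤1 ⟩
        ℚ.∣ a ∣ ℚ.+ 1ℚ                 ∎

⟼-positive : ∀ {s b} → s ⟼ b → 0ℚ ℚ.< b → ∃ λ N → ∀ n → N ≤ n → ½ ℚ.* b ℚ.≤ s n
⟼-positive {s} {b} hs 0<b = let (N , h) = close hs (½ ℚ.* b) (halve 0<b) in N , λ n N≤n → ℚ.<⇒≤ (subst₂ ℚ._<_
  (solveℚ 1 (λ b → b :- con ½ :* b := con ½ :* b) refl b)
  (solveℚ 2 (λ s h → (s :+ h) :- h := s) refl (s n) (½ ℚ.* b))
  (ℚ.+-monoˡ-< (ℚ.- (½ ℚ.* b))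
    (∣-∣-<⇒< {b} {s n} (subst (ℚ._< ½ ℚ.* b) (∣-∣-sym (s n) b) (h n N≤n)))))

⟼-recip : ∀ {s b} → s ⟼ b → 0ℚ ℚ.< b → (λ n → recip (s n)) ⟼ recip b
⟼-recip {s} {b} hs 0<b = converges λ ε 0<ε →
  let (M , h½) = ⟼-positive hs 0<b
      -- Clearing denominators multiplies the error by `x * b`, for which `½ * b * b` is a lower
      -- bound.
      (N , h)  = close hs (ε ℚ.* (½ ℚ.* b ℚ.* b)) (*-positive 0<ε (*-positive (halve 0<b) 0<b))
  in M ⊔ N , λ n ≤n →
    estimate ε 0<ε (s n) (h½ n (ℕ.m⊔n≤o⇒m≤o M N ≤n)) (h n (ℕ.m⊔n≤o⇒n≤o M N ≤n))
  where
  open ℚ.≤-Reasoning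
  estimate : ∀ ε → 0ℚ ℚ.< ε → ∀ x → ½ ℚ.* b ℚ.≤ x → ℚ.∣ x ℚ.- b ∣ ℚ.< ε ℚ.* (½ ℚ.* b ℚ.* b) → ℚ.∣ recip x ℚ.- recip b ∣ ℚ.< ε
  estimate ε 0<ε x ½b≤x lt = ℚ.*-cancelʳ-<-nonNeg (x ℚ.* b) ⦃ ℚ.nonNegative 0≤xb ⦄ (begin-strict
    ℚ.∣ recip x ℚ.- recip b ∣ ℚ.* (x ℚ.* b)
      ≡⟨ cong (ℚ.∣ recip x ℚ.- recip b ∣ ℚ.*_) (ℚ.0≤p⇒∣p∣≡p 0≤xb) ⟨
    ℚ.∣ recip x ℚ.- recip b ∣ ℚ.* ℚ.∣ x ℚ.* b ∣
      ≡⟨ ℚ.∣p*q∣≡∣p∣*∣q∣ (recip x ℚ.- recip b) (x ℚ.* b) ⟨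
    ℚ.∣ (recip x ℚ.- recip b) ℚ.* (x ℚ.* b) ∣
      ≡⟨ cong ℚ.∣_∣ (solveℚ 4 (λ r s x b → (r :- s) :* (x :* b) := r :* x :* b :- s :* b :* x) refl (recip x) (recip b) x b) ⟩
    ℚ.∣ recip x ℚ.* x ℚ.* b ℚ.- recip b ℚ.* b ℚ.* x ∣
      ≡⟨ cong₂ (λ r s → ℚ.∣ r ℚ.* b ℚ.- s ℚ.* x ∣) (recip-inverse x 0<x) (recip-inverse b 0<b) ⟩
    ℚ.∣ 1ℚ ℚ.* b ℚ.- 1ℚ ℚ.* x ∣
      ≡⟨ cong₂ (λ r s → ℚ.∣ r ℚ.- s ∣) (ℚ.*-identityˡ b) (ℚ.*-identityˡ x) ⟩
    ℚ.∣ b ℚ.- x ∣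
      ≡⟨ ∣-∣-sym b x ⟩
    ℚ.∣ x ℚ.- b ∣
      <⟨ lt ⟩
    ε ℚ.* (½ ℚ.* b ℚ.* b)
      ≤⟨ ℚ.*-monoˡ-≤-nonNeg ε ⦃ ℚ.nonNegative (ℚ.<⇒≤ 0<ε) ⦄
           (ℚ.*-monoʳ-≤-nonNeg b ⦃ ℚ.nonNegative (ℚ.<⇒≤ 0<b) ⦄ ½b≤x) ⟩
    ε ℚ.* (x ℚ.* b) ∎)
    where
    0<x = ℚ.<-≤-trans (halve 0<b) ½b≤x
    0≤xb = ℚ.<⇒≤ (*-positive 0<x 0<b)

⟼-∑ : ∀ {X : Set} {g : X → ℝ} {q : X → ℚ} → (∀ x → seq (g x) ⟼ q x) →
  ∀ xs → seq (∑ (map g xs)) ⟼ ∑ℚ (map q xs)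
⟼-∑ h []       = ⟼-const 0ℚ
⟼-∑ h (x ∷ xs) = ⟼-+ (h x) (⟼-∑ h xs)

0<-⟼ : ∀ {x b} → seq x ⟼ b → 0ℚ ℚ.< b → 0ᴿ <ᴿ x
0<-⟼ {x} {b} h 0<b = let (N , h½) = ⟼-positive h 0<b in ½ ℚ.* b , halve 0<b , N , λ n N≤n →
  subst (ℚ._≤ seq x n) (sym (ℚ.+-identityˡ (½ ℚ.* b))) (h½ n N≤n)

-- Chains driven by the Plancherel function

P : Partition → ℚ
P μ = (f μ ⁄ size μ !) ⦃ ℕ._!≢0 (size μ) ⦄

P>0 : ∀ μ → 0ℚ ℚ.< P μ
P>0 μ = ⁄-pos (f μ) (size μ !) ⦃ d∅-nonZero μ ⦄ ⦃ ℕ._!≢0 (size μ) ⦄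

-- Defined for all pairs: on an edge it is the transition probability, and since it is
-- multiplicative (`R-trans`) it is also the probability of each single path between its arguments.
R : Partition → Partition → ℚ
R μ ν = P ν ℚ.* recip (P μ)

R>0 : ∀ μ ν → 0ℚ ℚ.< R μ ν
R>0 μ ν = *-positive (P>0 ν) (recip-positive (P>0 μ))

R-refl : ∀ μ → R μ μ ≡ 1ℚ
R-refl μ = trans (ℚ.*-comm (P μ) (recip (P μ))) (recip-inverse (P μ) (P>0 μ))

R-trans : ∀ μ κ ν → R μ κ ℚ.* R κ ν ≡ R μ ν
R-trans μ κ ν = begin
  (P κ ℚ.* recip (P μ)) ℚ.* (P ν ℚ.* recip (P κ))
    ≡⟨ solveℚ 4 (λ k m n r → (k :* m) :* (n :* r) := (n :* m) :* (r :* k)) refl (P κ) (recip (P μ)) (P ν) (recip (P κ)) ⟩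
  R μ ν ℚ.* (recip (P κ) ℚ.* P κ)
    ≡⟨ cong (R μ ν ℚ.*_) (recip-inverse (P κ) (P>0 κ)) ⟩
  R μ ν ℚ.* 1ℚ
    ≡⟨ ℚ.*-identityʳ (R μ ν) ⟩
  R μ ν ∎
  where open ≡-Reasoning

R-∅ : ∀ ν → R ∅ ν ≡ P ν
R-∅ ν = trans (cong (P ν ℚ.*_) (recip-⁄ 1 1)) (ℚ.*-identityʳ (P ν))

R-edge : ∀ {μ ν} → μ ↗ ν →
  R μ ν ≡ (f ν ⁄ (suc (size μ) * f μ)) ⦃ ℕ.m*n≢0 (suc (size μ)) (f μ) ⦃ _ ⦄ ⦃ d∅-nonZero μ ⦄ ⦄
R-edge {μ} {ν} e = begin
  (f ν ⁄ size ν !) ℚ.* recip (f μ ⁄ size μ !)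
    ≡⟨ cong ((f ν ⁄ size ν !) ℚ.*_) (recip-⁄ (f μ) (size μ !)) ⟩
  (f ν ⁄ size ν !) ℚ.* (size μ ! ⁄ f μ)
    ≡⟨ ⁄-* (f ν) (size ν !) (size μ !) (f μ) ⟩
  (f ν * size μ !) ⁄ (size ν ! * f μ)
    ≡⟨ ⁄-≡ (f ν * size μ !) (size ν ! * f μ) (f ν) (suc (size μ) * f μ) eq ⟩
  f ν ⁄ (suc (size μ) * f μ) ∎
  where
  open ≡-Reasoning
  instance
    fμ≢0  = d∅-nonZero μ
    μ!≢0  = ℕ._!≢0 (size μ)
    ν!≢0  = ℕ._!≢0 (size ν)
    ν!fμ≢0 = ℕ.m*n≢0 (size ν !) (f μ)
    sμfμ≢0 = ℕ.m*n≢0 (suc (size μ)) (f μ)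
  shuffle : ∀ a b c d → a * b * (c * d) ≡ a * (c * b * d)
  shuffle = solve-∀
  eq : f ν * size μ ! * (suc (size μ) * f μ) ≡ f ν * (size ν ! * f μ)
  eq = trans (shuffle (f ν) (size μ !) (suc (size μ)) (f μ))
    (cong (λ n → f ν * (n ! * f μ)) (sym (↗-size e)))

∑-P : ∀ μ → ∑ℚ (map (P ∘ proj₁) (up μ)) ≡ P μ
∑-P μ = begin
  ∑ℚ (map (P ∘ proj₁) (up μ))
    ≡⟨ cong ∑ℚ (List.map-cong (λ (ν , e) → ⁄-≡ (f ν) (size ν !) (f ν) (suc (size μ) !)
         ⦃ ℕ._!≢0 (size ν) ⦄ (cong (λ n → f ν * n !) (sym (↗-size e)))) (up μ)) ⟩
  ∑ℚ (map (λ e → f (proj₁ e) ⁄ suc (size μ) !) (up μ))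
    ≡⟨ ∑-⁄ (f ∘ proj₁) (suc (size μ) !) (up μ) ⟩
  A f μ ⁄ suc (size μ) !
    ≡⟨ ⁄-≡ (A f μ) (suc (size μ) !) (f μ) (size μ !)
         (trans (cong (_* size μ !) (f-A (size μ) μ refl)) (shuffle (suc (size μ)) (f μ) (size μ !))) ⟩
  P μ ∎
  where
  open ≡-Reasoning
  instance
    μ!≢0  = ℕ._!≢0 (size μ)
    sμ!≢0 = ℕ._!≢0 (suc (size μ))
  shuffle : ∀ a b c → a * b * c ≡ b * (a * c)
  shuffle = solve-∀

∑-R : ∀ μ → ∑ℚ (map (R μ ∘ proj₁) (up μ)) ≡ 1ℚ
∑-R μ = trans (∑-*ʳ (P ∘ proj₁) (recip (P μ)) (up μ))
  (trans (cong (ℚ._* recip (P μ)) (∑-P μ)) (R-refl μ))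

⟼-subst : ∀ {s q r} → q ≡ r → s ⟼ q → s ⟼ r
⟼-subst refl h = h

plancherel-harmonic : Harmonic plancherel
plancherel-harmonic =
  join-≈ {plancherel ∅} {1ᴿ} (⟼-const 1ℚ) (⟼-const 1ℚ) ,
  λ μ → join-≈ {plancherel μ} {∑ (map (plancherel ∘ proj₁) (up μ))} (⟼-const (P μ))
    (⟼-subst (∑-P μ) (⟼-∑ (λ e → ⟼-const (P (proj₁ e))) (up μ)))

-- Asking only for the limits of `h` covers both `plancherel` and a subsequential limit, whose
-- representing sequences need not be constant.
module Driven {C : MarkovChain} {h : Partition → ℝ}
  (driven : C DrivenBy h) (h⟼P : ∀ μ → seq (h μ) ⟼ P μ) where

  open _DrivenBy_ driven

  positive : ∀ μ → 0ᴿ <ᴿ h μ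
  positive μ = 0<-⟼ {h μ} (h⟼P μ) (P>0 μ)

  state : ∀ μ → State C μ
  state μ = Equivalence.from (support μ) (positive μ)

  p⟼R : ∀ {μ ν} → μ ↗ ν → seq (p C μ ν) ⟼ R μ ν
  p⟼R {μ} {ν} e = ≈-⟼ {p C μ ν} {h ν *ᴿ (h μ ⁻¹) (positive μ)} (ratio e (positive μ))
    (⟼-* (h⟼P ν) (⟼-recip (h⟼P μ) (P>0 μ)))

pathProb⟼R : ∀ C → (∀ {μ ν} → μ ↗ ν → seq (p C μ ν) ⟼ R μ ν) →
  ∀ {μ ν} (w : μ ⇝ ν) → seq (pathProb C w) ⟼ R μ ν
pathProb⟼R C h {μ} done = ⟼-subst (sym (R-refl μ)) (⟼-const 1ℚ)
pathProb⟼R C h {μ} {ν} (_◅_ {j = κ} e w) = ⟼-subst (R-trans μ κ ν)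
  (⟼-* (h e) (pathProb⟼R C h w))

Q : Partition → ℚ
Q μ = ((f μ ^ 2) ⁄ size μ !) ⦃ ℕ._!≢0 (size μ) ⦄

-- One factor `f μ` is the number of paths, the other comes from their common probability `P μ`.
ℙ⟼ : ∀ C → (∀ {μ ν} → μ ↗ ν → seq (p C μ ν) ⟼ R μ ν) →
  ∀ μ → seq (ℙ C (size μ) μ) ⟼ Q μ
ℙ⟼ C h μ = ⟼-subst total
  (⟼-∑
    (λ w → ⟼-subst (R-∅ μ) (pathProb⟼R C h w)) (walks (size μ) ∅ μ))
  where
  instance μ!≢0 = ℕ._!≢0 (size μ)

  sum-const : ∀ {X : Set} m (xs : List X) → sum (map (const m) xs) ≡ length xs * m
  sum-const m []       = refl
  sum-const m (x ∷ xs) = cong (m +_) (sum-const m xs)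

  total : ∑ℚ (map (const (P μ)) (walks (size μ) ∅ μ)) ≡ Q μ
  total = trans (∑-⁄ (const (f μ)) (size μ !) (walks (size μ) ∅ μ))
    (⁄-≡ (sum (map (const (f μ)) (walks (size μ) ∅ μ))) (size μ !) (f μ ^ 2) (size μ !)
      (cong (_* size μ !) (trans (sum-const (f μ) (walks (size μ) ∅ μ))
        (cong (f μ *_) (sym (ℕ.*-identityʳ (f μ)))))))

growth⇔ : ∀ C → IsPlancherelGrowth C ⇔ (HasPlancherelMarginals C × HasPlancherelTransitions C)
growth⇔ C = mk⇔ to from
  where
  to : IsPlancherelGrowth C → HasPlancherelMarginals C × HasPlancherelTransitions C
  to (_ , driven) =
    (λ μ → join-≈ {ℙ C (size μ) μ} {fromℚ (Q μ)} (ℙ⟼ C p⟼R μ) (⟼-const (Q μ))) ,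
    (λ {μ} {ν} _ e → join-≈ {p C μ ν} {fromℚ _} (p⟼R e) (⟼-subst (sym (R-edge e)) (⟼-const _)))
    where open Driven driven (λ μ → ⟼-const (P μ))

  from : HasPlancherelMarginals C × HasPlancherelTransitions C → IsPlancherelGrowth C
  from (_ , transitions) = plancherel-harmonic , record
    { support = λ μ → mk⇔ (λ _ → 0<-⟼ {plancherel μ} (⟼-const (P μ)) (P>0 μ)) (λ _ → state (start C) (fromRoot μ))
    ; ratio   = λ {μ} {ν} e 0<h → join-≈ {p C μ ν} {plancherel ν *ᴿ (plancherel μ ⁻¹) 0<h}
        (p⟼R (state (start C) (fromRoot μ)) e) (⟼-const (R μ ν))
    }
    where
    p⟼R : ∀ {μ ν} → State C μ → μ ↗ ν → seq (p C μ ν) ⟼ R μ ν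
    p⟼R {μ} {ν} s e = ≈-⟼ {p C μ ν} {fromℚ _} (transitions s e) (⟼-subst (sym (R-edge e)) (⟼-const _))

    -- The transition formula speaks only of states, so the full state space is recovered along
    -- paths from the empty diagram: each edge has positive probability, and `p-closed` makes its
    -- end a state.
    state : ∀ {μ ν} → State C μ → μ ⇝ ν → State C ν
    state s done = s
    state {μ} s (_◅_ {j = κ} e w) =
      state (p-closed C s (0<-⟼ {p C μ κ} (p⟼R s e) (R>0 μ κ))) w

-- The Plancherel growth process as a chain

edge? : ∀ μ ν → Dec (μ ↗ ν)
edge? μ ν = Dec.map′ from to (ν ∈? covers μ)
  where
  open DecMembership _≟_ using (_∈?_)
  from : ν ∈ covers μ → μ ↗ ν
  from m with ∈-map⁻ proj₁ m
  ... | (_ , e) , _ , refl = e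
  to : μ ↗ ν → ν ∈ covers μ
  to e = ∈-map⁺ proj₁ (∈-up e)

-- `R` is positive on all pairs, whereas a chain must give 0 off the edges; hence the test by
-- `edge?`.
prob : Partition → Partition → ℚ
prob μ ν = if Dec.does (edge? μ ν) then R μ ν else 0ℚ

prob-edge : ∀ {μ ν} → μ ↗ ν → prob μ ν ≡ R μ ν
prob-edge {μ} {ν} e = cong (if_then R μ ν else 0ℚ) (Dec.dec-true (edge? μ ν) e)

prob-¬edge : ∀ {μ ν} → ¬ (μ ↗ ν) → prob μ ν ≡ 0ℚ
prob-¬edge {μ} {ν} ¬e = cong (if_then R μ ν else 0ℚ) (Dec.dec-false (edge? μ ν) ¬e)

prob≥0 : ∀ μ ν → 0ℚ ℚ.≤ prob μ ν
prob≥0 μ ν = if≥0 (Dec.does (edge? μ ν))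
  where
  if≥0 : ∀ b → 0ℚ ℚ.≤ (if b then R μ ν else 0ℚ)
  if≥0 true  = ℚ.<⇒≤ (R>0 μ ν)
  if≥0 false = ℚ.≤-refl

growthProcess : MarkovChain
growthProcess = record
  { State    = λ _ → ⊤
  ; p        = λ μ ν → fromℚ (prob μ ν)
  ; start    = tt
  ; p-nonneg = λ {μ} ν _ ε 0<ε → 0 , λ _ _ → ℚ.+-mono-≤ (prob≥0 μ ν) (ℚ.<⇒≤ 0<ε)
  ; p-edges  = λ {μ} {ν} _ ¬e → join-≈ {fromℚ (prob μ ν)} {0ᴿ}
      (⟼-subst (prob-¬edge ¬e) (⟼-const (prob μ ν))) (⟼-const 0ℚ)
  ; p-sum    = λ {μ} _ → join-≈ {∑ (map (λ e → fromℚ (prob μ (proj₁ e))) (up μ))} {1ᴿ}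
      (⟼-subst (∑-R μ) (⟼-∑
        (λ (ν , e) → ⟼-subst (prob-edge e) (⟼-const (prob μ ν))) (up μ)))
      (⟼-const 1ℚ)
  ; p-closed = λ _ _ → tt
  }

growthProcess-driven : growthProcess DrivenBy plancherel
growthProcess-driven = record
  { support = λ μ → mk⇔ (λ _ → 0<-⟼ {plancherel μ} (⟼-const (P μ)) (P>0 μ)) (λ _ → tt)
  ; ratio   = λ {μ} {ν} e 0<h → join-≈ {fromℚ (prob μ ν)} {plancherel ν *ᴿ (plancherel μ ⁻¹) 0<h}
      (⟼-subst (prob-edge e) (⟼-const (prob μ ν))) (⟼-const (R μ ν))
  }

-- The limit of `φ n` and uniqueness

φ-⁄ : ∀ k μ .⦃ _ : ℕ.NonZero (t (k + size μ)) ⦄ → φ (k + size μ) μ ≡ a k μ ⁄ t (k + size μ)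
φ-⁄ k μ = ⁄-≡ (d𝕐 μ n) (d𝕐 ∅ n) (a k μ) (t n) ⦃ d∅𝕐-nonZero n ⦄ (cong₂ _*_ (d𝕐-a k μ) (sym d∅≡t))
  where
  n = k + size μ
  d∅≡t : d𝕐 ∅ n ≡ t n
  d∅≡t = trans (cong (d𝕐 ∅) (sym (ℕ.+-identityʳ n))) (trans (d𝕐-a n ∅) (a-∅ n))

t-positive : ∀ n → 1 ≤ t n
t-positive n = t-mono (z≤n {n})

φ-close : ∀ μ {ε} → 0ℚ ℚ.< ε → ∃ λ K → ∀ n → K ≤ n →
  (φ n μ ℚ.≤ P μ ℚ.+ ε) × (P μ ℚ.≤ φ n μ ℚ.+ ε)
φ-close μ {ε} 0<ε =
  let (l , 1/L≤ε) = archimedean 0<ε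
      (x , y , x-small , y-small , eq) = a-asymptotic μ
      (K , hx) = x-small (suc l)
      (M , hy) = y-small (suc l)
  in K ⊔ M + size μ , λ n ≤n →
    -- The asymptotics are indexed by the number of steps from `μ` up to level `n`, so the threshold
    -- is shifted by `size μ`.
    let k   = n ∸ size μ
        n≡  = ℕ.m∸n+n≡m (ℕ.≤-trans (ℕ.m≤n+m (size μ) (K ⊔ M)) ≤n)
        ≤k  = ℕ.m+n≤o⇒m≤o∸n (K ⊔ M) ≤n
        T≢0 = ℕ.>-nonZero (t-positive (k + size μ))
        (≤₁ , ≤₂) = ⁄-close {a k μ} {t (k + size μ)} {f μ} {size μ !} (suc l) ⦃ T≢0 ⦄ ⦃ ℕ._!≢0 (size μ) ⦄ (eq k)
          (hx k (ℕ.m⊔n≤o⇒m≤o K M ≤k)) (hy k (ℕ.m⊔n≤o⇒n≤o K M ≤k))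
        φ≡ = trans (cong (λ m → φ m μ) (sym n≡)) (φ-⁄ k μ ⦃ T≢0 ⦄)
    in ℚ.≤-trans (ℚ.≤-reflexive φ≡) (ℚ.≤-trans ≤₁ (ℚ.+-monoʳ-≤ (P μ) 1/L≤ε)) ,
       ℚ.≤-trans ≤₂ (ℚ.+-mono-≤ (ℚ.≤-reflexive (sym φ≡)) 1/L≤ε)

<ᴿ-fromℚ : ∀ {q r ε} → 0ℚ ℚ.< ε → q ℚ.≤ r ℚ.+ ½ ℚ.* ε → fromℚ q <ᴿ fromℚ r +ᴿ fromℚ ε
<ᴿ-fromℚ {q} {r} {ε} 0<ε q≤ = ½ ℚ.* ε , halve 0<ε , 0 , λ _ _ → begin
  q ℚ.+ ½ ℚ.* ε                  ≤⟨ ℚ.+-monoˡ-≤ (½ ℚ.* ε) q≤ ⟩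
  r ℚ.+ ½ ℚ.* ε ℚ.+ ½ ℚ.* ε      ≡⟨ ℚ.+-assoc r _ _ ⟩
  r ℚ.+ (½ ℚ.* ε ℚ.+ ½ ℚ.* ε)    ≡⟨ cong (r ℚ.+_) (½+½ ε) ⟩
  r ℚ.+ ε                        ∎
  where open ℚ.≤-Reasoning

plancherel-limit : IsSubsequentialLimit plancherel
plancherel-limit = id , (λ k → ℕ.≤-refl) , λ μ ε 0<ε →
  let (K , h) = φ-close μ (halve 0<ε)
  in K , λ k K≤k → <ᴿ-fromℚ {φ k μ} {P μ} 0<ε (proj₁ (h k K≤k)) , <ᴿ-fromℚ {P μ} {φ k μ} 0<ε (proj₂ (h k K≤k))

increasing-≤ : ∀ {σ : ℕ → ℕ} → (∀ k → σ k < σ (suc k)) → ∀ k → k ≤ σ k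
increasing-≤ inc zero    = z≤n
increasing-≤ inc (suc k) = ℕ.≤-<-trans (increasing-≤ inc k) (inc k)

<ᴿ⇒< : ∀ {x y : ℝ} → x <ᴿ y → ∃ λ N → ∀ n → N ≤ n → seq x n ℚ.< seq y n
<ᴿ⇒< {x} {y} (δ , 0<δ , N , h) = N , λ n N≤n → ℚ.<-≤-trans
  (subst (ℚ._< seq x n ℚ.+ δ) (ℚ.+-identityʳ (seq x n)) (ℚ.+-monoʳ-< (seq x n) 0<δ)) (h n N≤n)

limit⟼P : ∀ {h} → IsSubsequentialLimit h → ∀ μ → seq (h μ) ⟼ P μ
limit⟼P {h} (σ , inc , lim) μ = converges λ ε 0<ε →
  let (K , hφ) = φ-close μ (halve 0<ε)
      (M , hσ) = lim μ (½ ℚ.* ε) (halve 0<ε)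
      -- One member of the subsequence links the two values: `φ (σ k) μ` is within `½ * ε` of `P μ`,
      -- because `σ k` is at least `k`, and within `½ * ε` of all late terms of `h μ`.
      k = K ⊔ M
      q = φ (σ k) μ
      (q≤ , P≤) = hφ (σ k) (ℕ.≤-trans (ℕ.m≤m⊔n K M) (increasing-≤ inc k))
      (q<h , h<q) = hσ k (ℕ.m≤n⊔m K M)
      (N , lt)  = <ᴿ⇒< {fromℚ q} {h μ +ᴿ fromℚ (½ ℚ.* ε)} q<h
      (N′ , lt′) = <ᴿ⇒< {h μ} {fromℚ q +ᴿ fromℚ (½ ℚ.* ε)} h<q
  in N ⊔ N′ , λ n ≤n → ∣-∣-< {seq (h μ) n} {P μ} {ε}
       (ℚ.<-≤-trans (lt′ n (ℕ.m⊔n≤o⇒n≤o N N′ ≤n)) (double ε q (P μ) q≤))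
       (ℚ.≤-<-trans P≤ (combine ε q (seq (h μ) n) (lt n (ℕ.m⊔n≤o⇒m≤o N N′ ≤n))))
  where
  twice : ∀ ε x → x ℚ.+ ½ ℚ.* ε ℚ.+ ½ ℚ.* ε ≡ x ℚ.+ ε
  twice ε x = trans (ℚ.+-assoc x _ _) (cong (x ℚ.+_) (½+½ ε))
  double : ∀ ε x y → x ℚ.≤ y ℚ.+ ½ ℚ.* ε → x ℚ.+ ½ ℚ.* ε ℚ.≤ y ℚ.+ ε
  double ε x y le = subst (x ℚ.+ ½ ℚ.* ε ℚ.≤_) (twice ε y) (ℚ.+-monoˡ-≤ (½ ℚ.* ε) le)
  combine : ∀ ε x y → x ℚ.< y ℚ.+ ½ ℚ.* ε → x ℚ.+ ½ ℚ.* ε ℚ.< y ℚ.+ ε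
  combine ε x y lt = subst (x ℚ.+ ½ ℚ.* ε ℚ.<_) (twice ε y) (ℚ.+-monoˡ-< (½ ℚ.* ε) lt)

MERW-unique : ∀ C → IsMERW C → C ≋ growthProcess
MERW-unique C (h , limit , driven) =
  (λ μ → mk⇔ (λ _ → tt) (λ _ → state μ)) , same
  where
  open Driven driven (limit⟼P {h} limit)

  same : ∀ {μ} ν → State C μ → p C μ ν ≈ fromℚ (prob μ ν)
  same {μ} ν s = case edge? μ ν of λ
    { (yes e) → join-≈ {p C μ ν} {fromℚ (prob μ ν)} (p⟼R e)
        (⟼-subst (prob-edge e) (⟼-const (prob μ ν)))
    ; (no ¬e) → join-≈ {p C μ ν} {fromℚ (prob μ ν)} (≈-⟼ {p C μ ν} {0ᴿ} (p-edges C s ¬e) (⟼-const 0ℚ))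
        (⟼-subst (prob-¬edge ¬e) (⟼-const (prob μ ν)))
    }

proposition2p5 : (∃ λ C → IsMERW C × IsPlancherelGrowth C × (∀ C′ → IsMERW C′ → C′ ≋ C))
    × (∀ C → IsPlancherelGrowth C ⇔ (HasPlancherelMarginals C × HasPlancherelTransitions C))
proposition2p5 =
  (growthProcess , (plancherel , plancherel-limit , growthProcess-driven) ,
    (plancherel-harmonic , growthProcess-driven) , MERW-unique) ,
  growth⇔
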